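{- Let $s, k, e_1, \ldots, e_s$ be integers, all at least $2$, such that $k < v$, where $v := \prod_{i=1}^s e_i$. Let $\mathscr{P}$ be a set of size $v$ and let $\mathscr{C}_0\prec\mathscr{C}_1\prec\cdots\prec\mathscr{C}_s$ be a chain of partitions of $\mathscr{P}$, where $\mathscr{C}_0$ is the partition into singletons and $\mathscr{C}_s=\{\mathscr{P}\}$, such that for $1 \leq i \leq s$ each class of $\mathscr{C}_i$ contains exactly $e_i$ classes of $\mathscr{C}_{i-1}$. Let $d := \gcd(e_1 - 1, \ldots, e_s - 1)$, and for each $i \in \{1, \ldots, s\}$ let $$y_i := 1 + \frac{k-1}{v-1} \left( \left(\prod_{j=1}^i e_j\right) - 1 \right)$$ (so $y_s=k$). Then there exist a $2$-$(v,k,\lambda)$ design $\mathscr{D}$ with point set $\mathscr{P}$, for some $\lambda$, and a group $G\leq \mathrm{Aut}(\mathscr{D})$ such that $G$ is flag-transitive on $\mathscr{D}$ and preserves each of the partitions $\mathscr{C}_0,\dots,\mathscr{C}_s$, if and only if the following conditions both hold: (FT1) $v-1$ divides $(k-1)d$; and (FT2) for each $i \in \{1, \ldots, s-1\}$, $y_{i}$ is a positive integer dividing $(e_{i+1} - 1)\left(\prod_{j=1}^{i} e_j\right)/d$. Moreover, if (FT1) and (FT2) hold and $\mathscr{D} = (\mathscr{P},\mathscr{B})$ is such a design (that is, a $2$-$(v,k,\lambda)$ design for some $\lambda$ admitting a flag-transitive group of automorphisms preserving each $\mathscr{C}_i$) then, for each $i \in \{1, \ldots, s\}$, each class $C \in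 \mathscr{C}_i$ and each block $B \in \mathscr{B}$, $|B \cap C| \in \{0,y_i\}$.
   Context: A $2$-$(v,k,\lambda)$ design is a pair $\mathscr{D}=(\mathscr{P},\mathscr{B})$ where $\mathscr{P}$ is a set of $v$ points, $\mathscr{B}$ is a nonempty set of $k$-element subsets of $\mathscr{P}$ (blocks), and any two distinct points are contained in exactly $\lambda$ blocks. $\mathrm{Aut}(\mathscr{D})$ is the group of permutations of $\mathscr{P}$ that map $\mathscr{B}$ to itself. A flag is a pair $(\delta,B)\in\mathscr{P}\times\mathscr{B}$ with $\delta\in B$; $G\le\mathrm{Aut}(\mathscr{D})$ is flag-transitive if it is transitive on the set of flags. For partitions of $\mathscr{P}$, $\mathscr{C}\prec\mathscr{C}'$ means that each $\mathscr{C}$-class is a proper subset of some $\mathscr{C}'$-class. $G$ preserves a partition if it permutes its classes. -}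

module Defs where

open import Data.Fin using (Fin; zero; suc; fromℕ; inject₁; toℕ)
open import Data.Fin.Permutation
  using (Permutation′; _⟨$⟩ʳ_; _⟨$⟩ˡ_; _≈_; id; flip; _∘ₚ_)
open import Data.Fin.Subset using (Subset; _⊂_; Nonempty; ∣_∣; ⁅_⁆; ⊤) renaming (_∈_ to _∈ˢ_)
open import Data.Fin.Subset.Properties using (_⊆?_) renaming (_∈?_ to _∈ˢ?_)
open import Data.Integer using (+_)
open import Data.List using (List; []; _∷_; length; filter; map; allFin)
open import Data.List.Membership.Propositional using (_∈_)
open import Data.List.Relation.Binary.BagAndSetEquality using (_∼[_]_; set)
open import Data.List.Relation.Unary.Unique.Propositional using (Unique)
open import Data.Nat using (ℕ; zero; suc; _*_; _∸_; _≤_; _<_; _/_; NonZero; >-nonZero; ≢-nonZero)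
open import Data.Nat.Divisibility using (_∣_)
open import Data.Nat.GCD using (gcd; gcd[m,n]≡0⇒m≡0)
open import Data.Nat.Properties using (≤-trans; ∸-monoˡ-≤; <⇒≤; <⇒≢)
open import Data.Product using (∃!; ∃-syntax; Σ-syntax; _×_)
open import Data.Rational as ℚ using (ℚ; 1ℚ)
open import Data.Vec using (tabulate; lookup)
open import Data.Vec.Functional using (Vector; foldr)
open import Level using (0ℓ) renaming (suc to lsuc)
open import Relation.Binary.PropositionalEquality using (_≡_; _≢_; sym)
open import Relation.Nullary.Decidable using (_×-dec_)
open import Relation.Unary using (Pred)

private
  variable
    s v k λ′ : ℕ

-- Sequences e₁, …, eₛ are functions on Fin s, so e_{j+1} is  e j  with j
-- counted from 0.  Indices running over 0, …, s live in Fin (suc s).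

-- ∏ e i  is the product of the first i entries of e.
∏ : Vector ℕ s → Fin (suc s) → ℕ
∏           e zero    = 1
∏ {suc s} e (suc i) = e zero * ∏ (λ j → e (suc j)) i

numPoints : Vector ℕ s → ℕ
numPoints {s} e = ∏ e (fromℕ s)

gcdPred : Vector ℕ s → ℕ
gcdPred e = foldr gcd 0 (λ j → e j ∸ 1)

numPoints∸1-nonZero : (e : Vector ℕ s) → 2 ≤ k → k < numPoints e → NonZero (numPoints e ∸ 1)
numPoints∸1-nonZero e 2≤k k<v = >-nonZero (∸-monoˡ-≤ 1 (≤-trans 2≤k (<⇒≤ k<v)))

gcdPred-nonZero : (e : Vector ℕ s) → 2 ≤ s → (∀ j → 2 ≤ e j) → NonZero (gcdPred e)
gcdPred-nonZero {suc s} e _ 2≤e =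
  ≢-nonZero (λ d≡0 → <⇒≢ (∸-monoˡ-≤ 1 (2≤e zero)) (sym (gcd[m,n]≡0⇒m≡0 d≡0)))

-- The number yᵢ, for i = 0, …, s (with y₀ = 1).
y : (k : ℕ) (e : Vector ℕ s) .{{_ : NonZero (numPoints e ∸ 1)}} → Fin (suc s) → ℚ
y k e i = 1ℚ ℚ.+ (+ (k ∸ 1) ℚ./ (numPoints e ∸ 1)) ℚ.* (+ (∏ e i ∸ 1) ℚ./ 1)

FT1 : (k : ℕ) (e : Vector ℕ s) → Set
FT1 k e = (numPoints e ∸ 1) ∣ ((k ∸ 1) * gcdPred e)

-- For j : Fin s, put i = toℕ j: then  e j  is e_{i+1} and  inject₁ j  is i in
-- {0, …, s}.  The natural number division by gcd(e₁ - 1, …, eₛ - 1) is exact.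
FT2 : (k : ℕ) (e : Vector ℕ s) .{{_ : NonZero (numPoints e ∸ 1)}} .{{_ : NonZero (gcdPred e)}} → Set
FT2 {s} k e = (j : Fin s) → 1 ≤ toℕ j →
  ∃[ m ] (y k e (inject₁ j) ≡ + m ℚ./ 1
         × 0 < m
         × m ∣ (((e j ∸ 1) * ∏ e (inject₁ j)) / gcdPred e))

-- Sets of subsets of Fin v are duplicate-free lists, compared via _∼[ set ]_
-- (same members).

record Partition (v : ℕ) : Set where
  field
    classes  : List (Subset v)
    unique   : Unique classes
    nonempty : ∀ {X} → X ∈ classes → Nonempty X
    covers   : ∀ x → ∃! _≡_ (λ X → X ∈ classes × x ∈ˢ X)

open Partition public using (classes)

infix 4 _≺_

_≺_ : Partition v → Partition v → Set
𝒞 ≺ 𝒞′ = ∀ {X} → X ∈ classes 𝒞 → ∃[ Y ] (Y ∈ classes 𝒞′ × X ⊂ Y)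

record PartitionChain {s} (e : Vector ℕ s) : Set where
  field
    𝒞      : Fin (suc s) → Partition (numPoints e)
    bottom : classes (𝒞 zero) ∼[ set ] map ⁅_⁆ (allFin (numPoints e))
    top    : classes (𝒞 (fromℕ s)) ∼[ set ] (⊤ ∷ [])
    chain  : (j : Fin s) → 𝒞 (inject₁ j) ≺ 𝒞 (suc j)
    index  : (j : Fin s) → ∀ {X} → X ∈ classes (𝒞 (suc j)) →
             length (filter (_⊆? X) (classes (𝒞 (inject₁ j)))) ≡ e j

open PartitionChain public using (𝒞)

record Design (v k λ′ : ℕ) : Set where
  field
    blocks    : List (Subset v)
    unique    : Unique blocks
    nonempty  : ∃[ B ] B ∈ blocks
    blockSize : ∀ {B} → B ∈ blocks → ∣ B ∣ ≡ k
    balanced  : ∀ {x x′} → x ≢ x′ →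
                length (filter (λ B → (x ∈ˢ? B) ×-dec (x′ ∈ˢ? B)) blocks) ≡ λ′

open Design public using (blocks)

image : Permutation′ v → Subset v → Subset v
image g X = tabulate (λ x → lookup X (g ⟨$⟩ˡ x))

Preserves : Permutation′ v → List (Subset v) → Set
Preserves g 𝒳 = map (image g) 𝒳 ∼[ set ] 𝒳

Aut : Design v k λ′ → Pred (Permutation′ v) 0ℓ
Aut 𝒟 g = Preserves g (blocks 𝒟)

-- A subgroup of the symmetric group on Fin v.  Permutations are identified
-- when they agree pointwise, hence the field resp.
record PermutationGroup (v : ℕ) : Set (lsuc 0ℓ) where
  field
    member    : Pred (Permutation′ v) 0ℓ
    resp      : ∀ {g h} → g ≈ h → member g → member h
    id-closed : member id
    ∘-closed  : ∀ {g h} → member g → member h → member (g ∘ₚ h)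
    ⁻¹-closed : ∀ {g} → member g → member (flip g)

open PermutationGroup public using (member)

FlagTransitive : PermutationGroup v → Design v k λ′ → Set
FlagTransitive G 𝒟 =
  ∀ {δ B δ′ B′} → B ∈ blocks 𝒟 → δ ∈ˢ B → B′ ∈ blocks 𝒟 → δ′ ∈ˢ B′ →
  ∃[ g ] (member G g × g ⟨$⟩ʳ δ ≡ δ′ × image g B ≡ B′)

AdmitsFlagTransitive : {e : Vector ℕ s} → PartitionChain e →
                       Design (numPoints e) k λ′ → Set (lsuc 0ℓ)
AdmitsFlagTransitive {e = e} ch 𝒟 =
  Σ[ G ∈ PermutationGroup (numPoints e) ]
    ( (∀ {g} → member G g → Aut 𝒟 g)
    × FlagTransitive G 𝒟
    × (∀ {g} → member G g → ∀ i → Preserves g (classes (𝒞 ch i))))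

{-# OPTIONS --safe #-}

-- Flag-transitivity makes |B ∩ C| depend only on i for blocks B meeting C ∈ 𝒞ᵢ,
-- and counting the pairs (y , B) with x , y ∈ B and y in the 𝒞ᵢ-class of x gives
-- r yᵢ = r + λ (∏ᵢ e - 1), where r is the number of blocks on x.  As the yᵢ form a
-- divisibility chain, (FT1) and (FT2) follow, (k - 1) d / (v - 1) being coprime to
-- each yᵢ.  Conversely (FT1) and (FT2) make yᵢ₊₁ / yᵢ an integer fᵢ ≤ eᵢ₊₁; the
-- blocks are then all k-sets meeting each class of each 𝒞ᵢ in 0 or yᵢ points, and G
-- is the full stabiliser of the chain, an iterated wreath product.  It is transitive
-- on flags, and the stabiliser of a point x is transitive on the points first joined
-- to x at a given level, so the same count determines the number of blocks on each pair.
module Submission where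

open import Defs
open import Data.Nat.Properties hiding (_≟_)
open import Algebra.Properties.Semiring.Sum +-*-semiring
  using (sum; sum-cong-≗; sum-remove; ∑-distrib-+; ∑-comm; sum-permute; *-distribˡ-sum; *-distribʳ-sum; sum-replicate-zero)
open import Data.Bool using (Bool; true; false; if_then_else_; _∧_; not)
open import Data.Bool.Properties using () renaming (_≟_ to _≟ᵇ_)
open import Data.Fin using (Fin; zero; suc; toℕ; fromℕ; inject₁; cast; combine; remQuot; _↑ˡ_; _↑ʳ_; punchIn; punchOut; _≟_)
open import Data.Fin.Induction using (<-weakInduction)
open import Data.Fin.Permutation as Perm
  using (Permutation′; permutation; _⟨$⟩ʳ_; _⟨$⟩ˡ_; inverseˡ; inverseʳ; insert; transpose; flip; _∘ₚ_)
open import Data.Fin.Properties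
  using (all?; any?; combine-injective; combine-remQuot; injective⇒≤; punchIn-punchOut; punchInᵢ≢i;
         punchOut-injective; remQuot-combine; toℕ-cast; toℕ-injective)
open import Data.Fin.Subset using (Subset; ∣_∣; ⁅_⁆; _⊆_; _∩_) renaming (_∈_ to _∈ˢ_)
open import Data.Fin.Subset.Properties using (_⊆?_; x∈⁅y⁆⇒x≡y; x∈p∩q⁻) renaming (_∈?_ to _∈ˢ?_)
open import Data.Integer as ℤ using (+_)
import Data.Integer.Properties as ℤₚ
open import Data.List as List using (List; []; _∷_; _++_; filter; length; map)
open import Data.List.Membership.Propositional using (_∈_)
open import Data.List.Membership.Propositional.Properties using (∈-filter⁺; ∈-filter⁻; ∈-map⁺; ∈-map⁻; ∈-++⁺ˡ; ∈-++⁺ʳ)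
open import Data.List.Membership.Propositional.Properties.WithK using (unique⇒irrelevant; unique∧set⇒bag)
open import Data.List.Relation.Binary.BagAndSetEquality using (∼bag⇒↭)
open import Data.List.Relation.Binary.Permutation.Propositional.Properties using (↭-length; filter-↭)
open import Data.List.Relation.Unary.All using ([])
open import Data.List.Relation.Unary.AllPairs using ([]; _∷_)
open import Data.List.Relation.Unary.Any using (index; here; there)
open import Data.List.Relation.Unary.Any.Properties using (lookup-index)
open import Data.List.Relation.Unary.Unique.Propositional using (Unique)
open import Data.List.Relation.Unary.Unique.Propositional.Properties using (map⁺; ++⁺; filter⁺)
open import Data.Nat as ℕ
  using (ℕ; zero; suc; _+_; _*_; _∸_; _≤_; _<_; _/_; z≤n; s≤s; _<?_; NonZero; >-nonZero; ≢-nonZero⁻¹)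
open import Data.Nat.Coprimality using (Coprime; coprime-divisor)
open import Data.Nat.Divisibility
  using (_∣_; quotient; 1∣_; _∣0; n∣m*n; ∣-refl; ∣-trans; ∣1⇒≡1; ∣m+n∣m⇒∣n; ∣m∣n⇒∣m+n; ∣m⇒∣m*n; ∣n⇒∣m*n; *-monoʳ-∣)
open import Data.Nat.DivMod using (m/n*n≡m; m*n/n≡m; /-congˡ)
open import Data.Nat.GCD using (gcd[m,n]∣m; gcd[m,n]∣n; gcd-greatest; c*gcd[m,n]≡gcd[cm,cn])
open import Data.Nat.Solver using (module +-*-Solver)
open import Data.Product using (Σ-syntax; _×_; _,_; proj₁; proj₂; ∃-syntax)
open import Data.Rational as ℚ using (ℚ; 1ℚ; toℚᵘ)
open import Data.Rational.Properties using (toℚᵘ-cong; toℚᵘ-fromℚᵘ; toℚᵘ-homo-*; toℚᵘ-homo-+; toℚᵘ-injective)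
open import Data.Rational.Unnormalised as ℚᵘ using (mkℚᵘ; *≡*)
import Data.Rational.Unnormalised.Properties as ℚᵘₚ
open import Data.Sum using (_⊎_; inj₁; inj₂)
open import Data.Vec using (lookup; tabulate; []; _∷_)
open import Data.Vec.Functional using (Vector; removeAt)
open import Data.Vec.Properties
  using ([]=⇒lookup; lookup⇒[]=; lookup∘tabulate; tabulate∘lookup; tabulate-cong; lookup-zipWith; ∷-injectiveʳ)
open import Function using (_∘_)
open import Function.Bundles using (_⇔_; mk⇔; module Equivalence)
open import Function.Definitions using (Injective)
open import Function.Properties.Equivalence using () renaming (trans to ⇔-trans; sym to ⇔-sym; refl to ⇔-refl)
open import Relation.Binary.PropositionalEquality
open import Relation.Nullary using (¬_; Dec; yes; no; does; contradiction)
open import Relation.Nullary.Decidable using (dec-true; dec-false; does-⇔; _×-dec_; _→-dec_)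

-- Dropping the lowest partition of a `PartitionChain` leaves the point set unchanged, so induction
-- on `s` does not apply to it directly. Each chain is therefore carried by a bijection to a
-- coordinate model, where forgetting the lowest coordinate gives a shorter chain on fewer points.
-- There a set meeting every 𝒞₁-class in 0 or `c` points is governed by the set of classes it meets:
-- all larger intersections are `c` times those of this projection. Hence the divisibility chain,
-- yᵢ₊₁ / yᵢ being the number of 𝒞ᵢ-classes met inside one 𝒞ᵢ₊₁-class, and hence also
-- flag-transitivity, by lifting from the projection.
--
-- Both directions turn on one equation over ℕ, yᵢ (v - 1) = (v - 1) + (k - 1) (∏ᵢ e - 1).
-- Consecutive levels differ by (k - 1) (eᵢ₊₁ - 1) ∏ᵢ e, and ∏ᵢ e divides v, so it is coprime to v -
-- 1 and can be cancelled; this is (FT1). In the converse, one level up, the intersection and the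
-- class grow in the fixed ratio (k - 1) / (v - 1), so the number of blocks on a pair does not see
-- the level at which the pair is joined. The bound fᵢ ≤ eᵢ₊₁ reduces to k ≤ v.

private
  variable
    s m n v : ℕ

-- Sums over Fin n and matchings of subsets of Fin n

ind : Bool → ℕ
ind b = if b then 1 else 0

sum-++ : ∀ m {n} (h : Fin (m + n) → ℕ) → sum h ≡ sum (h ∘ (_↑ˡ n)) + sum (h ∘ (m ↑ʳ_))
sum-++ zero    h = refl
sum-++ (suc m) h = trans (cong (λ z → h zero + z) (sum-++ m (h ∘ suc))) (sym (+-assoc (h zero) _ _))

sum-combine : ∀ m {n} (h : Fin (m * n) → ℕ) → sum h ≡ sum {m} (λ i → sum {n} (λ j → h (combine i j)))
sum-combine zero        h = refl
sum-combine (suc m) {n} h = trans (sum-++ n h) (cong (λ z → sum (h ∘ (_↑ˡ (m * n))) + z) (sum-combine m (h ∘ (n ↑ʳ_))))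

sum-zero : (f : Fin n → ℕ) → (∀ i → f i ≡ 0) → sum f ≡ 0
sum-zero {n} f f≗0 = trans (sum-cong-≗ {n} f≗0) (sum-replicate-zero n)

sum-supported-at : (x : Fin n) (f : Fin n → ℕ) → (∀ i → i ≢ x → f i ≡ 0) → sum f ≡ f x
sum-supported-at {suc n} x f f≡0 = begin
  sum f                      ≡⟨ sum-remove {i = x} f ⟩
  f x + sum (removeAt f x)   ≡⟨ cong (λ z → f x + z) (sum-zero (removeAt f x) (λ i → f≡0 (punchIn x i) (punchInᵢ≢i x i))) ⟩
  f x + 0                    ≡⟨ +-identityʳ (f x) ⟩
  f x                        ∎
  where open ≡-Reasoning

sum-const : ∀ n c → sum {n} (λ _ → c) ≡ n * c
sum-const zero    c = refl
sum-const (suc n) c = cong (λ z → c + z) (sum-const n c)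

term≤sum : (f : Fin n → ℕ) (x : Fin n) → f x ≤ sum f
term≤sum {suc n} f x = ≤-trans (m≤m+n (f x) _) (≤-reflexive (sym (sum-remove {i = x} f)))

sum≢0⇒term≢0 : (f : Fin n → ℕ) → sum f ≢ 0 → ∃[ x ] f x ≢ 0
sum≢0⇒term≢0 {zero}  f Σ≢0 = contradiction refl Σ≢0
sum≢0⇒term≢0 {suc n} f Σ≢0 with f zero in eq
... | suc _ = zero , λ f0≡0 → 1+n≢0 (trans (sym eq) f0≡0)
... | zero  with sum≢0⇒term≢0 (f ∘ suc) Σ≢0
...   | x , fx≢0 = suc x , fx≢0

ind-true : ∀ {b} → ind b ≢ 0 → b ≡ true
ind-true {true}  _  = refl
ind-true {false} ≢0 = contradiction refl ≢0

-- If `T` misses the colour of `S zero`, it is constant and its count is `0` or `suc n`; the entry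
-- `S zero`, being of the other colour, excludes that count for `S`.
∃-same-colour : (S T : Fin (suc n) → Bool) → sum (ind ∘ S) ≡ sum (ind ∘ T) →
                ∃[ t ] T t ≡ S zero
∃-same-colour S T eq with any? (λ t → T t ≟ᵇ S zero)
... | yes found = found
... | no  none  with S zero
...   | true = contradiction (trans eq (sum-zero (ind ∘ T) (λ t → ≡false t (T t) refl))) (λ ())
  where
  ≡false : ∀ t b → T t ≡ b → ind b ≡ 0
  ≡false t false _ = refl
  ≡false t true  p = contradiction (t , p) none
∃-same-colour {n} S T eq | no none | false =
  contradiction (≤-trans (≤-reflexive (sym full)) (≤-trans (≤-reflexive (sym eq)) (≤-tail (S ∘ suc)))) (<⇒≱ ≤-refl)
  where
  ≡true : ∀ t b → T t ≡ b → ind b ≡ 1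
  ≡true t true  _ = refl
  ≡true t false p = contradiction (t , p) none

  full : sum (ind ∘ T) ≡ suc n
  full = trans (sum-cong-≗ {suc n} (λ t → ≡true t (T t) refl)) (trans (sum-const (suc n) 1) (*-identityʳ (suc n)))

  ≤-tail : ∀ {l} (f : Fin l → Bool) → sum (ind ∘ f) ≤ l
  ≤-tail {zero}  f = z≤n
  ≤-tail {suc l} f with f zero
  ... | true  = s≤s (≤-tail (f ∘ suc))
  ... | false = m≤n⇒m≤1+n (≤-tail (f ∘ suc))

insert-at : ∀ (i j : Fin (suc n)) (π : Permutation′ n) → insert i j π ⟨$⟩ʳ i ≡ j
insert-at i j π with i ≟ i
... | yes _   = refl
... | no  i≢i = contradiction refl i≢i

insert-colour : (S T : Fin (suc n) → Bool) {i j : Fin (suc n)} (π : Permutation′ n) → S i ≡ T j →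
                (∀ x → S (punchIn i x) ≡ T (punchIn j (π ⟨$⟩ʳ x))) →
                ∀ x → S x ≡ T (insert i j π ⟨$⟩ʳ x)
insert-colour S T {i} {j} π Si≡Tj rest x with i ≟ x
... | yes refl = Si≡Tj
... | no  i≢x  = trans (cong S (sym (punchIn-punchOut i≢x))) (rest (punchOut i≢x))

removeAt-count : (S T : Fin (suc n) → Bool) {i j : Fin (suc n)} → S i ≡ T j →
                 sum (ind ∘ S) ≡ sum (ind ∘ T) →
                 sum (ind ∘ S ∘ punchIn i) ≡ sum (ind ∘ T ∘ punchIn j)
removeAt-count S T {i} {j} Si≡Tj eq = +-cancelˡ-≡ (ind (S i)) _ _ (begin
  ind (S i) + sum (ind ∘ S ∘ punchIn i)  ≡⟨ sum-remove {i = i} (ind ∘ S) ⟨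
  sum (ind ∘ S)                          ≡⟨ eq ⟩
  sum (ind ∘ T)                          ≡⟨ sum-remove {i = j} (ind ∘ T) ⟩
  ind (T j) + sum (ind ∘ T ∘ punchIn j)  ≡⟨ cong (λ b → ind b + sum (ind ∘ T ∘ punchIn j)) Si≡Tj ⟨
  ind (S i) + sum (ind ∘ T ∘ punchIn j)  ∎)
  where open ≡-Reasoning

matching : (S T : Fin n → Bool) → sum (ind ∘ S) ≡ sum (ind ∘ T) →
           ∃[ π ] (∀ x → S x ≡ T (π ⟨$⟩ʳ x))
matching {zero}  S T eq = Perm.id , λ ()
matching {suc n} S T eq with ∃-same-colour S T eq
... | t , Tt≡S0 with matching (S ∘ suc) (T ∘ punchIn t) (removeAt-count S T {zero} (sym Tt≡S0) eq)
...   | π , S≗Tπ = insert zero t π , insert-colour S T π (sym Tt≡S0) S≗Tπ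

-- The prescribed pair is taken out first and the rest is matched freely. This is what lets the
-- point of a flag travel with its block.
pointedMatching : (S T : Fin n → Bool) → sum (ind ∘ S) ≡ sum (ind ∘ T) → ∀ {i j} → S i ≡ T j →
                  ∃[ π ] ((∀ x → S x ≡ T (π ⟨$⟩ʳ x)) × π ⟨$⟩ʳ i ≡ j)
pointedMatching {suc n} S T eq {i} {j} Si≡Tj
  with π , S≗Tπ ← matching (S ∘ punchIn i) (T ∘ punchIn j) (removeAt-count S T Si≡Tj eq)
  = insert i j π , insert-colour S T π Si≡Tj S≗Tπ , insert-at i j π

-- The standard chain of partitions

-- Peeling off e₁ identifies Fin (∏ e) with Fin e₁ × Fin (∏ (e ∘ suc)); the
-- second component is the 𝒞₁-class in the standard chain  agree  below.
above : (e : Vector ℕ (suc s)) → Fin (numPoints e) → Fin (numPoints (e ∘ suc))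
above e x = proj₂ (remQuot {e zero} (numPoints (e ∘ suc)) x)

below : (e : Vector ℕ (suc s)) → Fin (numPoints e) → Fin (e zero)
below e x = proj₁ (remQuot {e zero} (numPoints (e ∘ suc)) x)

place : (e : Vector ℕ (suc s)) → Fin (e zero) → Fin (numPoints (e ∘ suc)) → Fin (numPoints e)
place e t a = combine t a

above-place : (e : Vector ℕ (suc s)) (t : Fin (e zero)) (a : Fin (numPoints (e ∘ suc))) → above e (place e t a) ≡ a
above-place e t a = cong proj₂ (remQuot-combine t a)

below-place : (e : Vector ℕ (suc s)) (t : Fin (e zero)) (a : Fin (numPoints (e ∘ suc))) → below e (place e t a) ≡ t
below-place e t a = cong proj₁ (remQuot-combine t a)

place-η : (e : Vector ℕ (suc s)) (x : Fin (numPoints e)) → place e (below e x) (above e x) ≡ x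
place-η e x = combine-remQuot {e zero} (numPoints (e ∘ suc)) x

-- Level `i` forgets the lowest `i` coordinates. The recursion peels the same factor as `∏`, so
-- level `s` compares elements of `Fin 1`.
agree : (e : Vector ℕ s) → Fin (suc s) → Fin (numPoints e) → Fin (numPoints e) → Set
agree         e zero    a b = a ≡ b
agree {suc s} e (suc i) a b = agree (e ∘ suc) i (above e a) (above e b)

agree? : (e : Vector ℕ s) (i : Fin (suc s)) (a b : Fin (numPoints e)) → Dec (agree e i a b)
agree?         e zero    a b = a ≟ b
agree? {suc s} e (suc i) a b = agree? (e ∘ suc) i (above e a) (above e b)

agree-refl : (e : Vector ℕ s) (i : Fin (suc s)) {a : Fin (numPoints e)} → agree e i a a
agree-refl         e zero    = refl
agree-refl {suc s} e (suc i) = agree-refl (e ∘ suc) i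

agree-sym : (e : Vector ℕ s) (i : Fin (suc s)) {a b : Fin (numPoints e)} → agree e i a b → agree e i b a
agree-sym         e zero    = sym
agree-sym {suc s} e (suc i) = agree-sym (e ∘ suc) i

agree-trans : (e : Vector ℕ s) (i : Fin (suc s)) {a b c : Fin (numPoints e)} →
              agree e i a b → agree e i b c → agree e i a c
agree-trans         e zero    = trans
agree-trans {suc s} e (suc i) = agree-trans (e ∘ suc) i

agree-top : (e : Vector ℕ s) (a b : Fin (numPoints e)) → agree e (fromℕ s) a b
agree-top {zero}  e zero zero = refl
agree-top {suc s} e a    b    = agree-top (e ∘ suc) (above e a) (above e b)

agree-suc : (e : Vector ℕ s) (j : Fin s) {a b : Fin (numPoints e)} → agree e (inject₁ j) a b → agree e (suc j) a b
agree-suc e zero    refl = refl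
agree-suc e (suc j) a~b  = agree-suc (e ∘ suc) j a~b

-- The search climbs from the lowest level and must stop, since all points agree at the top.
splitLevel : (e : Vector ℕ s) (a b : Fin (numPoints e)) → a ≢ b →
             ∃[ j ] (agree e (suc j) a b × ¬ agree e (inject₁ j) a b)
splitLevel {zero}  e a b a≢b = contradiction (agree-top e a b) a≢b
splitLevel {suc s} e a b a≢b with above e a ≟ above e b
... | yes eq = zero , eq , a≢b
... | no neq with splitLevel (e ∘ suc) (above e a) (above e b) neq
...   | j , agr , ¬agr = suc j , agr , ¬agr

-- Automorphisms of the standard chain

Automorphism : (e : Vector ℕ s) → Permutation′ (numPoints e) → Set
Automorphism e g = ∀ i a b → agree e i a b ⇔ agree e i (g ⟨$⟩ʳ a) (g ⟨$⟩ʳ b)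

wreath : (e : Vector ℕ (suc s)) → (Fin (numPoints (e ∘ suc)) → Permutation′ (e zero)) →
         Permutation′ (numPoints (e ∘ suc)) → Permutation′ (numPoints e)
wreath e h g = permutation to from to-from from-to
  where
  to from : Fin (numPoints e) → Fin (numPoints e)
  to   x = place e (h (above e x) ⟨$⟩ʳ below e x) (g ⟨$⟩ʳ above e x)
  -- `h` is indexed by the class before the move, so the inverse must consult it at the preimage of
  -- the present class.
  from x = place e (h (g ⟨$⟩ˡ above e x) ⟨$⟩ˡ below e x) (g ⟨$⟩ˡ above e x)

  to-from : ∀ x → to (from x) ≡ x
  to-from x
    rewrite above-place e (h (g ⟨$⟩ˡ above e x) ⟨$⟩ˡ below e x) (g ⟨$⟩ˡ above e x)
          | below-place e (h (g ⟨$⟩ˡ above e x) ⟨$⟩ˡ below e x) (g ⟨$⟩ˡ above e x)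
          | inverseʳ (h (g ⟨$⟩ˡ above e x)) {below e x}
          | inverseʳ g {above e x}
    = place-η e x

  from-to : ∀ x → from (to x) ≡ x
  from-to x
    rewrite above-place e (h (above e x) ⟨$⟩ʳ below e x) (g ⟨$⟩ʳ above e x)
          | below-place e (h (above e x) ⟨$⟩ʳ below e x) (g ⟨$⟩ʳ above e x)
          | inverseˡ g {above e x}
          | inverseˡ (h (above e x)) {below e x}
    = place-η e x

wreath-above : (e : Vector ℕ (suc s)) (h : Fin (numPoints (e ∘ suc)) → Permutation′ (e zero))
               (g : Permutation′ (numPoints (e ∘ suc))) (x : Fin (numPoints e)) →
               above e (wreath e h g ⟨$⟩ʳ x) ≡ g ⟨$⟩ʳ above e x
wreath-above e h g x = above-place e (h (above e x) ⟨$⟩ʳ below e x) (g ⟨$⟩ʳ above e x)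

wreath-automorphism : (e : Vector ℕ (suc s)) (h : Fin (numPoints (e ∘ suc)) → Permutation′ (e zero))
                      (g : Permutation′ (numPoints (e ∘ suc))) →
                      Automorphism (e ∘ suc) g → Automorphism e (wreath e h g)
wreath-automorphism e h g aut zero a b =
  mk⇔ (cong (wreath e h g ⟨$⟩ʳ_))
      (λ eq → trans (sym (inverseˡ (wreath e h g))) (trans (cong (wreath e h g ⟨$⟩ˡ_) eq) (inverseˡ (wreath e h g))))
wreath-automorphism e h g aut (suc i) a b
  rewrite wreath-above e h g a | wreath-above e h g b = aut i (above e a) (above e b)

id-automorphism : (e : Vector ℕ s) → Automorphism e Perm.id
id-automorphism e i a b = mk⇔ (λ p → p) (λ p → p)

-- Intersection numbers in the standard chain

meet : (e : Vector ℕ s) → Fin (suc s) → (Fin (numPoints e) → Bool) → Fin (numPoints e) → ℕ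
meet e i B x = sum (λ x′ → ind (B x′) * ind (does (agree? e i x x′)))

Uniform : (e f : Vector ℕ s) → (Fin (numPoints e) → Bool) → Set
Uniform e f B = ∀ i x → B x ≡ true → meet e i B x ≡ ∏ f i

fibre : (e : Vector ℕ (suc s)) → (Fin (numPoints e) → Bool) → Fin (numPoints (e ∘ suc)) → ℕ
fibre e B a = sum (λ t → ind (B (place e t a)))

meet-zero : (e : Vector ℕ s) (B : Fin (numPoints e) → Bool) (x : Fin (numPoints e)) →
            meet e zero B x ≡ ind (B x)
meet-zero e B x = begin
  meet e zero B x                     ≡⟨ sum-supported-at x _ off ⟩
  ind (B x) * ind (does (x ≟ x))      ≡⟨ cong (λ b → ind (B x) * ind b) (dec-true (x ≟ x) refl) ⟩
  ind (B x) * 1                       ≡⟨ *-identityʳ _ ⟩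
  ind (B x)                           ∎
  where
  open ≡-Reasoning
  off : ∀ i → i ≢ x → ind (B i) * ind (does (x ≟ i)) ≡ 0
  off i i≢x = trans (cong (λ b → ind (B i) * ind b) (dec-false (x ≟ i) (i≢x ∘ sym))) (*-zeroʳ (ind (B i)))

meet-suc : (e : Vector ℕ (suc s)) (i : Fin (suc s)) (B : Fin (numPoints e) → Bool) (x : Fin (numPoints e)) →
           meet e (suc i) B x ≡ sum (λ a → fibre e B a * ind (does (agree? (e ∘ suc) i (above e x) a)))
meet-suc e i B x = begin
  meet e (suc i) B x
    ≡⟨ sum-combine (e zero) _ ⟩
  sum (λ t → sum (λ a → ind (B (place e t a)) * ind (does (agree? (e ∘ suc) i (above e x) (above e (place e t a))))))
    ≡⟨ sum-cong-≗ {e zero} (λ t → sum-cong-≗ {numPoints (e ∘ suc)} (λ a →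
         cong (λ b → ind (B (place e t a)) * ind (does (agree? (e ∘ suc) i (above e x) b))) (above-place e t a))) ⟩
  sum (λ t → sum (λ a → ind (B (place e t a)) * ind (does (agree? (e ∘ suc) i (above e x) a))))
    ≡⟨ ∑-comm {e zero} {numPoints (e ∘ suc)} (λ t a → ind (B (place e t a)) * ind (does (agree? (e ∘ suc) i (above e x) a))) ⟩
  sum (λ a → sum (λ t → ind (B (place e t a)) * ind (does (agree? (e ∘ suc) i (above e x) a))))
    ≡⟨ sum-cong-≗ {numPoints (e ∘ suc)} (λ a →
         *-distribʳ-sum {e zero} (ind (does (agree? (e ∘ suc) i (above e x) a))) (λ t → ind (B (place e t a)))) ⟨
  sum (λ a → fibre e B a * ind (does (agree? (e ∘ suc) i (above e x) a)))
    ∎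
  where open ≡-Reasoning

meet-one : (e : Vector ℕ (suc s)) (B : Fin (numPoints e) → Bool) (x : Fin (numPoints e)) →
           meet e (suc zero) B x ≡ fibre e B (above e x)
meet-one e B x = begin
  meet e (suc zero) B x
    ≡⟨ meet-suc e zero B x ⟩
  sum (λ a → fibre e B a * ind (does (above e x ≟ a)))
    ≡⟨ sum-supported-at (above e x) _ (λ a a≢ →
         trans (cong (λ b → fibre e B a * ind b) (dec-false (above e x ≟ a) (a≢ ∘ sym))) (*-zeroʳ (fibre e B a))) ⟩
  fibre e B (above e x) * ind (does (above e x ≟ above e x))
    ≡⟨ cong (λ b → fibre e B (above e x) * ind b) (dec-true (above e x ≟ above e x) refl) ⟩
  fibre e B (above e x) * 1
    ≡⟨ *-identityʳ _ ⟩
  fibre e B (above e x)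
    ∎
  where open ≡-Reasoning

-- When all nonempty fibres have size `c`, counting points is `c` times counting the 𝒞₁-classes met.
-- Every induction on the levels below passes to the shorter chain in this way.
meet-constantFibre : (e : Vector ℕ (suc s)) (c : ℕ) (B : Fin (numPoints e) → Bool) (B′ : Fin (numPoints (e ∘ suc)) → Bool) →
                     (∀ a → fibre e B a ≡ c * ind (B′ a)) →
                     ∀ i x → meet e (suc i) B x ≡ c * meet (e ∘ suc) i B′ (above e x)
meet-constantFibre e c B B′ const i x = begin
  meet e (suc i) B x
    ≡⟨ meet-suc e i B x ⟩
  sum (λ a → fibre e B a * ind (does (agree? (e ∘ suc) i (above e x) a)))
    ≡⟨ sum-cong-≗ {numPoints (e ∘ suc)} (λ a →
         trans (cong (_* ind (does (agree? (e ∘ suc) i (above e x) a))) (const a)) (*-assoc c (ind (B′ a)) _)) ⟩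
  sum (λ a → c * (ind (B′ a) * ind (does (agree? (e ∘ suc) i (above e x) a))))
    ≡⟨ *-distribˡ-sum {numPoints (e ∘ suc)} c (λ a → ind (B′ a) * ind (does (agree? (e ∘ suc) i (above e x) a))) ⟨
  c * meet (e ∘ suc) i B′ (above e x)
    ∎
  where open ≡-Reasoning

classSize : (e : Vector ℕ s) (i : Fin (suc s)) (x : Fin (numPoints e)) → meet e i (λ _ → true) x ≡ ∏ e i
classSize         e zero    x = meet-zero e (λ _ → true) x
classSize {suc s} e (suc i) x =
  trans (meet-constantFibre e (e zero) (λ _ → true) (λ _ → true) (λ _ → sum-const (e zero) 1) i x)
        (cong (e zero *_) (classSize (e ∘ suc) i (above e x)))

count-< : ∀ n c → c ≤ n → sum {n} (λ t → ind (does (toℕ t <? c))) ≡ c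
count-< n       zero    _         = sum-zero {n} _ (λ t → cong ind (dec-false (toℕ t <? 0) λ ()))
count-< (suc n) (suc c) (s≤s c≤n) = cong suc (count-< n c c≤n)

-- A box in the coordinates: the coordinate at level `j` runs over the first `f j` values. It
-- witnesses that blocks exist.
uniformSet : (e f : Vector ℕ s) → Fin (numPoints e) → Bool
uniformSet {zero}  e f _ = true
uniformSet {suc s} e f x = uniformSet (e ∘ suc) (f ∘ suc) (above e x) ∧ does (toℕ (below e x) <? f zero)

uniformSet-fibre : (e f : Vector ℕ (suc s)) → f zero ≤ e zero →
                   ∀ a → fibre e (uniformSet e f) a ≡ f zero * ind (uniformSet (e ∘ suc) (f ∘ suc) a)
uniformSet-fibre e f f≤e a = trans (sum-cong-≗ {e zero} unplace) (∧-count (uniformSet (e ∘ suc) (f ∘ suc) a))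
  where
  unplace : ∀ t → ind (uniformSet e f (place e t a)) ≡
                  ind (uniformSet (e ∘ suc) (f ∘ suc) a ∧ does (toℕ t <? f zero))
  unplace t = cong₂ (λ b u → ind (uniformSet (e ∘ suc) (f ∘ suc) b ∧ does (toℕ u <? f zero)))
                    (above-place e t a) (below-place e t a)

  ∧-count : ∀ b → sum {e zero} (λ t → ind (b ∧ does (toℕ t <? f zero))) ≡ f zero * ind b
  ∧-count true  = trans (count-< (e zero) (f zero) f≤e) (sym (*-identityʳ (f zero)))
  ∧-count false = trans (sum-zero {e zero} _ (λ _ → refl)) (sym (*-zeroʳ (f zero)))

∧-trueˡ : ∀ {a b} → a ∧ b ≡ true → a ≡ true
∧-trueˡ {true} _ = refl

uniformSet-uniform : (e f : Vector ℕ s) → (∀ j → f j ≤ e j) → Uniform e f (uniformSet e f)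
uniformSet-uniform         e f f≤e zero    x x∈ = trans (meet-zero e (uniformSet e f) x) (cong ind x∈)
uniformSet-uniform {suc s} e f f≤e (suc i) x x∈ =
  trans (meet-constantFibre e (f zero) (uniformSet e f) (uniformSet (e ∘ suc) (f ∘ suc)) (uniformSet-fibre e f (f≤e zero)) i x)
        (cong (f zero *_) (uniformSet-uniform (e ∘ suc) (f ∘ suc) (f≤e ∘ suc) i (above e x) (∧-trueˡ x∈)))

uniformSet-nonempty : (e f : Vector ℕ s) → (∀ j → f j ≤ e j) → (∀ j → 1 ≤ f j) → ∃[ x ] uniformSet e f x ≡ true
uniformSet-nonempty {zero}  e f f≤e 1≤f = zero , refl
uniformSet-nonempty {suc s} e f f≤e 1≤f
  with uniformSet-nonempty (e ∘ suc) (f ∘ suc) (f≤e ∘ suc) (1≤f ∘ suc) | sum≢0⇒term≢0 {e zero} (λ t → ind (does (toℕ t <? f zero))) count≢0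
  where
  count≢0 : sum {e zero} (λ t → ind (does (toℕ t <? f zero))) ≢ 0
  count≢0 eq = <⇒≢ (1≤f zero) (trans (sym eq) (count-< (e zero) (f zero) (f≤e zero)))
... | a , a∈ | t , t< = place e t a ,
  cong₂ _∧_ (trans (cong (uniformSet (e ∘ suc) (f ∘ suc)) (above-place e t a)) a∈)
            (trans (cong (λ u → does (toℕ u <? f zero)) (below-place e t a)) (ind-true t<))

-- Projection to the set of 𝒞₁-classes met

project : (e : Vector ℕ (suc s)) → (Fin (numPoints e) → Bool) → Fin (numPoints (e ∘ suc)) → Bool
project e B a = does (any? (λ t → B (place e t a) ≟ᵇ true))

project-place : (e : Vector ℕ (suc s)) (B : Fin (numPoints e) → Bool) {x : Fin (numPoints e)} →
                B x ≡ true → project e B (above e x) ≡ true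
project-place e B {x} Bx = dec-true (any? (λ t → B (place e t (above e x)) ≟ᵇ true)) (below e x , trans (cong B (place-η e x)) Bx)

project-true : (e : Vector ℕ (suc s)) (B : Fin (numPoints e) → Bool) {a : Fin (numPoints (e ∘ suc))} →
               project e B a ≡ true → ∃[ t ] B (place e t a) ≡ true
project-true e B {a} _  with any? (λ t → B (place e t a) ≟ᵇ true)
project-true e B     _  | yes found = found
project-true e B     () | no _

project-false : (e : Vector ℕ (suc s)) (B : Fin (numPoints e) → Bool) {a : Fin (numPoints (e ∘ suc))} →
                project e B a ≡ false → ∀ t → ind (B (place e t a)) ≡ 0
project-false e B {a} p t with B (place e t a) in eq
... | false = refl
... | true  = contradiction (trans (sym p) (dec-true (any? (λ t → B (place e t a) ≟ᵇ true)) (t , eq))) (λ ())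

constant-fibre : (e : Vector ℕ (suc s)) (B : Fin (numPoints e) → Bool) (c : ℕ) →
                 (∀ x → B x ≡ true → meet e (suc zero) B x ≡ c) →
                 ∀ a → fibre e B a ≡ c * ind (project e B a)
constant-fibre e B c const a with project e B a in eq
... | false = trans (sum-zero {e zero} _ (project-false e B eq)) (sym (*-zeroʳ c))
... | true  with t , Bt ← project-true e B eq = begin
  fibre e B a                        ≡⟨ cong (fibre e B) (above-place e t a) ⟨
  fibre e B (above e (place e t a))  ≡⟨ meet-one e B (place e t a) ⟨
  meet e (suc zero) B (place e t a)  ≡⟨ const (place e t a) Bt ⟩
  c                                  ≡⟨ *-identityʳ c ⟨
  c * 1                              ∎
  where open ≡-Reasoning

meet-project : (e : Vector ℕ (suc s)) (B : Fin (numPoints e) → Bool) (c : ℕ) →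
               (∀ x → B x ≡ true → meet e (suc zero) B x ≡ c) →
               ∀ i t a → meet e (suc i) B (place e t a) ≡ c * meet (e ∘ suc) i (project e B) a
meet-project e B c const i t a =
  trans (meet-constantFibre e c B (project e B) (constant-fibre e B c const) i (place e t a))
        (cong (λ b → c * meet (e ∘ suc) i (project e B) b) (above-place e t a))

-- What flag-transitivity gives for a block: the intersection numbers are constant but their values
-- are not yet known, in contrast to `Uniform`.
Regular : (e : Vector ℕ s) → (Fin (numPoints e) → Bool) → Set
Regular e B = ∀ i x y → B x ≡ true → B y ≡ true → meet e i B x ≡ meet e i B y

1≤meet-one : (e : Vector ℕ (suc s)) (B : Fin (numPoints e) → Bool) {x : Fin (numPoints e)} → B x ≡ true →
             1 ≤ meet e (suc zero) B x
1≤meet-one e B {x} Bx = begin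
  1                                               ≡⟨ cong ind (trans (cong B (place-η e x)) Bx) ⟨
  ind (B (place e (below e x) (above e x)))       ≤⟨ term≤sum (λ t → ind (B (place e t (above e x)))) (below e x) ⟩
  fibre e B (above e x)                           ≡⟨ meet-one e B x ⟨
  meet e (suc zero) B x                           ∎
  where open ≤-Reasoning

project-regular : (e : Vector ℕ (suc s)) (B : Fin (numPoints e) → Bool) → Regular e B → Regular (e ∘ suc) (project e B)
project-regular e B reg i a b a∈ b∈ with t , Bt ← project-true e B a∈ | u , Bu ← project-true e B b∈ =
  *-cancelˡ-≡ _ _ c {{>-nonZero (1≤meet-one e B Bt)}} (begin
    c * meet (e ∘ suc) i (project e B) a   ≡⟨ meet-project e B c const i t a ⟨
    meet e (suc i) B (place e t a)         ≡⟨ reg (suc i) _ _ Bt Bu ⟩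
    meet e (suc i) B (place e u b)         ≡⟨ meet-project e B c const i u b ⟩
    c * meet (e ∘ suc) i (project e B) b   ∎)
  where
  open ≡-Reasoning
  c = meet e (suc zero) B (place e t a)

  const : ∀ x → B x ≡ true → meet e (suc zero) B x ≡ c
  const x Bx = reg (suc zero) x (place e t a) Bx Bt

-- The quotient counts the classes of level `j` that `B` meets inside one class of the next level.
-- At the lowest level the divisor is 1; above it, the size `c` of a fibre splits off from both
-- sides and the projection takes over.
meet-∣ : (e : Vector ℕ s) (B : Fin (numPoints e) → Bool) → Regular e B → ∀ j x → B x ≡ true →
         meet e (inject₁ j) B x ∣ meet e (suc j) B x
meet-∣ e B reg zero    x Bx = subst (_∣ meet e (suc zero) B x) (sym (trans (meet-zero e B x) (cong ind Bx))) (1∣ _)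
meet-∣ {suc s} e B reg (suc j) x Bx =
  subst₂ _∣_ (sym (meet≡ (inject₁ j))) (sym (meet≡ (suc j)))
    (*-monoʳ-∣ c (meet-∣ (e ∘ suc) (project e B) (project-regular e B reg) j (above e x) (project-place e B Bx)))
  where
  c = meet e (suc zero) B x

  meet≡ : ∀ i → meet e (suc i) B x ≡ c * meet (e ∘ suc) i (project e B) (above e x)
  meet≡ i = trans (cong (meet e (suc i) B) (sym (place-η e x)))
                  (meet-project e B c (λ z Bz → reg (suc zero) z x Bz Bx) i (below e x) (above e x))

uniform-fibre : (e f : Vector ℕ (suc s)) (B : Fin (numPoints e) → Bool) → Uniform e f B →
                ∀ a → fibre e B a ≡ f zero * ind (project e B a)
uniform-fibre e f B uni = constant-fibre e B (f zero) (λ x Bx → trans (uni (suc zero) x Bx) (*-identityʳ (f zero)))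

project-uniform : (e f : Vector ℕ (suc s)) (B : Fin (numPoints e) → Bool) → 1 ≤ f zero → Uniform e f B →
                  Uniform (e ∘ suc) (f ∘ suc) (project e B)
project-uniform e f B 1≤f uni i a a∈ with t , Bt ← project-true e B a∈ =
  *-cancelˡ-≡ _ _ (f zero) {{>-nonZero 1≤f}}
    (trans (sym (meet-project e B (f zero) (λ x Bx → trans (uni (suc zero) x Bx) (*-identityʳ (f zero))) i t a))
           (uni (suc i) (place e t a) Bt))

-- By induction some `g` carries the projected flag to the projected flag. A class and its image
-- under `g` are then both met in `f zero` points or both missed, so `B` and `B′` can be matched
-- class by class, and the matchings assemble to a wreath product element over `g`.
uniform-transitive : (e f : Vector ℕ s) → (∀ j → 1 ≤ f j) → (B B′ : Fin (numPoints e) → Bool) →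
                     Uniform e f B → Uniform e f B′ → ∀ {δ δ′} → B δ ≡ true → B′ δ′ ≡ true →
                     ∃[ g ] (Automorphism e g × g ⟨$⟩ʳ δ ≡ δ′ × (∀ x → B x ≡ B′ (g ⟨$⟩ʳ x)))
uniform-transitive {zero} e f 1≤f B B′ uB uB′ {zero} {zero} Bδ B′δ′ =
  Perm.id , id-automorphism e , refl , λ { zero → trans Bδ (sym B′δ′) }
uniform-transitive {suc s} e f 1≤f B B′ uB uB′ {δ} {δ′} Bδ B′δ′
  with g , g-aut , gδ≡δ′ , B≗B′g ← uniform-transitive (e ∘ suc) (f ∘ suc) (1≤f ∘ suc) (project e B) (project e B′)
         (project-uniform e f B (1≤f zero) uB) (project-uniform e f B′ (1≤f zero) uB′)
         (project-place e B Bδ) (project-place e B′ B′δ′)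
  = wreath e h g , wreath-automorphism e h g g-aut , maps-δ , maps-B
  where
  sameFibre : ∀ a → fibre e B a ≡ fibre e B′ (g ⟨$⟩ʳ a)
  sameFibre a = begin
    fibre e B a                              ≡⟨ uniform-fibre e f B uB a ⟩
    f zero * ind (project e B a)             ≡⟨ cong (λ b → f zero * ind b) (B≗B′g a) ⟩
    f zero * ind (project e B′ (g ⟨$⟩ʳ a))   ≡⟨ uniform-fibre e f B′ uB′ (g ⟨$⟩ʳ a) ⟨
    fibre e B′ (g ⟨$⟩ʳ a)                    ∎
    where open ≡-Reasoning

  -- The clause about `δ` is conditional on `a`, so that one family of matchings serves all classes;
  -- only the class of `δ` needs a pointed one.
  onFibre : ∀ a → ∃[ π ] ((∀ t → B (place e t a) ≡ B′ (place e (π ⟨$⟩ʳ t) (g ⟨$⟩ʳ a)))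
                         × (a ≡ above e δ → π ⟨$⟩ʳ below e δ ≡ below e δ′))
  onFibre a with a ≟ above e δ
  ... | no a≢ with π , π-B ← matching (λ t → B (place e t a)) (λ t → B′ (place e t (g ⟨$⟩ʳ a))) (sameFibre a)
    = π , π-B , λ a≡ → contradiction a≡ a≢
  ... | yes refl
    with π , π-B , π-δ ← pointedMatching (λ t → B (place e t a)) (λ t → B′ (place e t (g ⟨$⟩ʳ a))) (sameFibre a)
           {below e δ} {below e δ′}
           (trans (cong B (place-η e δ)) (trans Bδ (sym (trans (cong (λ b → B′ (place e (below e δ′) b)) gδ≡δ′)
             (trans (cong B′ (place-η e δ′)) B′δ′)))))
    = π , π-B , λ _ → π-δ

  h : Fin (numPoints (e ∘ suc)) → Permutation′ (e zero)
  h a = proj₁ (onFibre a)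

  maps-δ : wreath e h g ⟨$⟩ʳ δ ≡ δ′
  maps-δ = trans (cong₂ (place e) (proj₂ (proj₂ (onFibre (above e δ))) refl) gδ≡δ′) (place-η e δ′)

  maps-B : ∀ x → B x ≡ B′ (wreath e h g ⟨$⟩ʳ x)
  maps-B x = trans (cong B (sym (place-η e x))) (proj₁ (proj₂ (onFibre (above e x))) (below e x))

transpose-matchˡ : (i j : Fin n) → transpose i j ⟨$⟩ʳ i ≡ j
transpose-matchˡ i j with i ≟ i
... | yes _   = refl
... | no  i≢i = contradiction refl i≢i

transpose-other : {i j k : Fin n} → k ≢ i → k ≢ j → transpose i j ⟨$⟩ʳ k ≡ k
transpose-other {i = i} {j} {k} k≢i k≢j with k ≟ i
... | yes k≡i = contradiction k≡i k≢i
... | no  _ with k ≟ j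
...   | yes k≡j = contradiction k≡j k≢j
...   | no  _   = refl

-- At the lowest level `x`, `y`, `z` share a class and `x` differs from the other two there, so
-- swapping the coordinates of `y` and `z` in every class fixes `x`. Higher up, the classes are
-- moved by induction and the lowest coordinate is corrected afterwards.
fixing-transitive : (e : Vector ℕ s) (j : Fin s) {x y z : Fin (numPoints e)} →
                    agree e (suc j) x y → ¬ agree e (inject₁ j) x y →
                    agree e (suc j) x z → ¬ agree e (inject₁ j) x z →
                    ∃[ g ] (Automorphism e g × g ⟨$⟩ʳ x ≡ x × g ⟨$⟩ʳ y ≡ z)
fixing-transitive e zero {x} {y} {z} x~y x≢y x~z x≢z =
  wreath e h Perm.id , wreath-automorphism e h Perm.id (id-automorphism (e ∘ suc)) ,
  trans (cong (λ t → place e t (above e x)) (transpose-other (x≢y ∘ same x~y) (x≢z ∘ same x~z))) (place-η e x) ,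
  trans (cong₂ (place e) (transpose-matchˡ (below e y) (below e z)) (trans (sym x~y) x~z)) (place-η e z)
  where
  h : Fin (numPoints (e ∘ suc)) → Permutation′ (e zero)
  h _ = transpose (below e y) (below e z)

  same : ∀ {b} → above e x ≡ above e b → below e x ≡ below e b → x ≡ b
  same {b} p q = trans (sym (place-η e x)) (trans (cong₂ (place e) q p) (place-η e b))
fixing-transitive {suc s} e (suc j) {x} {y} {z} x~y x≁y x~z x≁z
  with g , g-aut , gx , gy ← fixing-transitive (e ∘ suc) j x~y x≁y x~z x≁z
  = wreath e h g , wreath-automorphism e h g g-aut ,
    trans (cong₂ (place e) (hx (above e x) refl) gx) (place-η e x) ,
    trans (cong₂ (place e) (hy (above e y) y≢x) gy) (place-η e z)
  where
  h : Fin (numPoints (e ∘ suc)) → Permutation′ (e zero)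
  -- The class of `x` is left alone, as the swap might move `x` inside it; `y` lies in another class
  -- and still receives the coordinate of `z`.
  h a with a ≟ above e x
  ... | yes _ = Perm.id
  ... | no  _ = transpose (below e y) (below e z)

  y≢x : above e y ≢ above e x
  y≢x eq = x≁y (subst (agree (e ∘ suc) (inject₁ j) (above e x)) (sym eq) (agree-refl (e ∘ suc) (inject₁ j)))

  hx : ∀ a → a ≡ above e x → h a ⟨$⟩ʳ below e x ≡ below e x
  hx a a≡ with a ≟ above e x
  ... | yes _  = refl
  ... | no  a≢ = contradiction a≡ a≢

  hy : ∀ a → a ≢ above e x → h a ⟨$⟩ʳ below e y ≡ below e z
  hy a a≢ with a ≟ above e x
  ... | yes a≡ = contradiction a≡ a≢
  ... | no  _  = transpose-matchˡ (below e y) (below e z)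

-- Reduction to the standard chain

injective⇒surjective : (f : Fin n → Fin n) → Injective _≡_ _≡_ f → ∀ y → ∃[ x ] f x ≡ y
injective⇒surjective {suc n} f inj y with any? (λ x → f x ≟ y)
... | yes found = found
... | no  none  = contradiction (injective⇒≤ {f = λ x → punchOut (avoids x)}
                                  (λ {a} {b} eq → inj (punchOut-injective (avoids a) (avoids b) eq))) 1+n≰n
  where
  avoids : ∀ x → y ≢ f x
  avoids x y≡fx = none (x , sym y≡fx)

injective⇒permutation : (f : Fin n → Fin n) → Injective _≡_ _≡_ f → ∃[ φ ] (∀ x → φ ⟨$⟩ʳ x ≡ f x)
injective⇒permutation f inj =
  permutation f (proj₁ ∘ surj) (proj₂ ∘ surj) (λ x → inj (proj₂ (surj (f x)))) , λ _ → refl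
  where surj = injective⇒surjective f inj

address : (e : Vector ℕ s) → (∀ j → Fin (e j)) → Fin (numPoints e)
address {zero}  e c = zero
address {suc s} e c = place e (c zero) (address (e ∘ suc) (λ j → c (suc j)))

-- Stated for arbitrary relations on a fixed carrier, because the recursion drops the lowest
-- relation while the points stay the same; the remainder of a `PartitionChain` is no longer one for
-- `e ∘ suc`.
address-agree : ∀ {A : Set} (e : Vector ℕ s) (E : Fin (suc s) → A → A → Set) (c : A → ∀ j → Fin (e j)) →
                (∀ x y → E (fromℕ s) x y) →
                (∀ j x y → E (inject₁ j) x y ⇔ (E (suc j) x y × c x j ≡ c y j)) →
                ∀ i x y → E i x y ⇔ agree e i (address e (c x)) (address e (c y))
address-agree {zero} e E c top step zero x y = mk⇔ (λ _ → refl) (λ _ → top x y)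
address-agree {suc s} e E c top step (suc i) x y
  rewrite above-place e (c x zero) (address (e ∘ suc) (λ j → c x (suc j)))
        | above-place e (c y zero) (address (e ∘ suc) (λ j → c y (suc j)))
  = address-agree (e ∘ suc) (E ∘ suc) (λ z j → c z (suc j)) top (λ j → step (suc j)) i x y
address-agree {suc s} e E c top step zero x y =
  ⇔-trans (step zero x y) (mk⇔
    (λ (E₁ , c≡) → cong₂ (place e) c≡ (Equivalence.to ih E₁))
    (λ eq → let c≡ , a≡ = combine-injective _ _ _ _ eq in Equivalence.from ih a≡ , c≡))
  where ih = address-agree (e ∘ suc) (E ∘ suc) (λ z j → c z (suc j)) top (λ j → step (suc j)) zero x y

-- The position does not depend on the membership proof, as the list is duplicate-free.
index-≡⇔ : ∀ {A : Set} {L L′ : List A} → L ≡ L′ → Unique L → ∀ {a b} (p : a ∈ L) (q : b ∈ L′) →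
           a ≡ b ⇔ toℕ (index p) ≡ toℕ (index q)
index-≡⇔ {L = L} refl unique p q = mk⇔ to from
  where
  to : _ ≡ _ → _
  to refl = cong (toℕ ∘ index) (unique⇒irrelevant unique p q)

  from : _ → _ ≡ _
  from eq = trans (lookup-index p) (trans (cong (List.lookup L) (toℕ-injective eq)) (sym (lookup-index q)))

module _ {v} (𝒫 : Partition v) where

  open Partition 𝒫 using (covers)

  classOf : Fin v → Subset v
  classOf x = proj₁ (covers x)

  classOf-∈ : ∀ x → classOf x ∈ classes 𝒫
  classOf-∈ x = proj₁ (proj₁ (proj₂ (covers x)))

  ∈-classOf : ∀ x → x ∈ˢ classOf x
  ∈-classOf x = proj₂ (proj₁ (proj₂ (covers x)))

  classOf-unique : ∀ {X x} → X ∈ classes 𝒫 → x ∈ˢ X → classOf x ≡ X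
  classOf-unique {x = x} X∈ x∈X = proj₂ (proj₂ (covers x)) (X∈ , x∈X)

module _ {e : Vector ℕ s} (ch : PartitionChain e) where

  open PartitionChain ch using (bottom; top; chain) renaming (index to subclass-count)

  private
    N = numPoints e

    cls : Fin (suc s) → Fin N → Subset N
    cls i = classOf (𝒞 ch i)

    sub : Fin s → Subset N → List (Subset N)
    sub j X = filter (_⊆? X) (classes (𝒞 ch (inject₁ j)))

    cls-enlarge : ∀ j x → cls (inject₁ j) x ⊆ cls (suc j) x
    cls-enlarge j x y∈ with Y , Y∈ , (⊆Y , _) ← chain j (classOf-∈ (𝒞 ch (inject₁ j)) x) =
      subst (_ ∈ˢ_) (sym (classOf-unique (𝒞 ch (suc j)) Y∈ (⊆Y (∈-classOf (𝒞 ch (inject₁ j)) x)))) (⊆Y y∈)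

    cls-∈-sub : ∀ j x → cls (inject₁ j) x ∈ sub j (cls (suc j) x)
    cls-∈-sub j x = ∈-filter⁺ (_⊆? cls (suc j) x) (classOf-∈ (𝒞 ch (inject₁ j)) x) (cls-enlarge j x)

    -- The subclasses of a class are numbered by their position in the filtered list, whose length
    -- is `e j` by the field `index` of the chain.
    coordinate : Fin N → ∀ j → Fin (e j)
    coordinate x j = cast (subclass-count j (classOf-∈ (𝒞 ch (suc j)) x)) (index (cls-∈-sub j x))

    -- Once the classes one level up coincide, both positions refer to the same duplicate-free list.
    -- They are compared through `toℕ`, since their types depend on lists that are only
    -- propositionally equal.
    cls-≡⇔ : ∀ j x y → (cls (inject₁ j) x ≡ cls (inject₁ j) y) ⇔
                       (cls (suc j) x ≡ cls (suc j) y × coordinate x j ≡ coordinate y j)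
    cls-≡⇔ j x y = mk⇔ to from
      where
      toℕ-coordinate : ∀ x → toℕ (coordinate x j) ≡ toℕ (index (cls-∈-sub j x))
      toℕ-coordinate x = toℕ-cast (subclass-count j (classOf-∈ (𝒞 ch (suc j)) x)) (index (cls-∈-sub j x))

      same : cls (suc j) x ≡ cls (suc j) y →
             (cls (inject₁ j) x ≡ cls (inject₁ j) y) ⇔ (toℕ (index (cls-∈-sub j x)) ≡ toℕ (index (cls-∈-sub j y)))
      same eq = index-≡⇔ (cong (sub j) eq) (filter⁺ (_⊆? cls (suc j) x) (Partition.unique (𝒞 ch (inject₁ j)))) (cls-∈-sub j x) (cls-∈-sub j y)

      to : cls (inject₁ j) x ≡ cls (inject₁ j) y → _
      to eq = eq′ , toℕ-injective (trans (toℕ-coordinate x) (trans (Equivalence.to (same eq′) eq) (sym (toℕ-coordinate y))))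
        where
        eq′ : cls (suc j) x ≡ cls (suc j) y
        eq′ = sym (classOf-unique (𝒞 ch (suc j)) (classOf-∈ (𝒞 ch (suc j)) x)
                (cls-enlarge j x (subst (y ∈ˢ_) (sym eq) (∈-classOf (𝒞 ch (inject₁ j)) y))))

      from : _ → _
      from (eq′ , c≡) = Equivalence.from (same eq′)
        (trans (sym (toℕ-coordinate x)) (trans (cong toℕ c≡) (toℕ-coordinate y)))

    cls-top : ∀ x y → cls (fromℕ s) x ≡ cls (fromℕ s) y
    cls-top x y = trans (isTop x) (sym (isTop y))
      where
      isTop : ∀ x → cls (fromℕ s) x ≡ _
      isTop x with here p ← Equivalence.to top (classOf-∈ (𝒞 ch (fromℕ s)) x) = p

    cls-bottom : ∀ {x y} → cls zero x ≡ cls zero y → x ≡ y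
    cls-bottom {x} {y} eq with z , _ , p ← ∈-map⁻ ⁅_⁆ (Equivalence.to bottom (classOf-∈ (𝒞 ch zero) x)) =
      trans (x∈⁅y⁆⇒x≡y z (subst (x ∈ˢ_) p (∈-classOf (𝒞 ch zero) x)))
            (sym (x∈⁅y⁆⇒x≡y z (subst (y ∈ˢ_) (trans (sym eq) p) (∈-classOf (𝒞 ch zero) y))))

    cls-agree : ∀ i x y → (cls i x ≡ cls i y) ⇔ agree e i (address e (coordinate x)) (address e (coordinate y))
    cls-agree = address-agree e (λ i x y → cls i x ≡ cls i y) coordinate cls-top cls-≡⇔

  abstract
    -- Every chain is, up to relabelling the points, the standard one.
    standardise : ∃[ φ ] (∀ i {X x} → X ∈ classes (𝒞 ch i) → x ∈ˢ X →
                          ∀ y → y ∈ˢ X ⇔ agree e i (φ ⟨$⟩ʳ x) (φ ⟨$⟩ʳ y))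
    standardise with φ , φ≗ ← injective⇒permutation (address e ∘ coordinate) (λ {x} {y} eq → cls-bottom (Equivalence.from (cls-agree zero x y) eq))
      = φ , λ i {X} {x} X∈ x∈X y → subst₂ (λ a b → y ∈ˢ X ⇔ agree e i a b) (sym (φ≗ x)) (sym (φ≗ y))
          (⇔-trans (mk⇔ (λ y∈X → trans (classOf-unique (𝒞 ch i) X∈ x∈X) (sym (classOf-unique (𝒞 ch i) X∈ y∈X)))
                        (λ eq → subst (y ∈ˢ_) (trans (sym eq) (classOf-unique (𝒞 ch i) X∈ x∈X)) (∈-classOf (𝒞 ch i) y)))
                   (cls-agree i x y))

-- Subsets, images and block counts

∣∣-sum : (B : Subset n) → ∣ B ∣ ≡ sum (ind ∘ lookup B)
∣∣-sum []          = refl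
∣∣-sum (true  ∷ B) = cong suc (∣∣-sum B)
∣∣-sum (false ∷ B) = ∣∣-sum B

∈?-lookup : (x : Fin n) (B : Subset n) → does (x ∈ˢ? B) ≡ lookup B x
∈?-lookup x B with x ∈ˢ? B
... | yes x∈ = sym ([]=⇒lookup x∈)
... | no  x∉ with lookup B x in eq
...   | true  = contradiction (lookup⇒[]= x B eq) x∉
...   | false = refl

lookup-image : (g : Permutation′ v) (B : Subset v) (x : Fin v) → lookup (image g B) (g ⟨$⟩ʳ x) ≡ lookup B x
lookup-image g B x = trans (lookup∘tabulate _ (g ⟨$⟩ʳ x)) (cong (lookup B) (inverseˡ g))

∈-image : (g : Permutation′ v) {B : Subset v} {x : Fin v} → x ∈ˢ B → g ⟨$⟩ʳ x ∈ˢ image g B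
∈-image g {B} {x} x∈B = lookup⇒[]= (g ⟨$⟩ʳ x) (image g B) (trans (lookup-image g B x) ([]=⇒lookup x∈B))

image-unique : (g : Permutation′ v) {B B′ : Subset v} → (∀ x → lookup B x ≡ lookup B′ (g ⟨$⟩ʳ x)) → image g B ≡ B′
image-unique g {B} {B′} eq =
  trans (tabulate-cong (λ x → trans (eq (g ⟨$⟩ˡ x)) (cong (lookup B′) (inverseʳ g)))) (tabulate∘lookup B′)

image-flip : (g : Permutation′ v) (B : Subset v) → image g (image (flip g) B) ≡ B
image-flip g B = image-unique g {image (flip g) B} (lookup∘tabulate (λ x → lookup B (g ⟨$⟩ʳ x)))

image-injective : (g : Permutation′ v) {B B′ : Subset v} → image g B ≡ image g B′ → B ≡ B′
image-injective g {B} {B′} eq = trans (sym (image-flip (flip g) B)) (trans (cong (image (flip g)) eq) (image-flip (flip g) B′))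

∣image∣ : (g : Permutation′ v) (B : Subset v) → ∣ image g B ∣ ≡ ∣ B ∣
∣image∣ {v} g B = begin
  ∣ image g B ∣                                     ≡⟨ ∣∣-sum (image g B) ⟩
  sum (ind ∘ lookup (image g B))                    ≡⟨ sum-permute (ind ∘ lookup (image g B)) g ⟩
  sum (λ x → ind (lookup (image g B) (g ⟨$⟩ʳ x)))   ≡⟨ sum-cong-≗ {v} (λ x → cong ind (lookup-image g B x)) ⟩
  sum (ind ∘ lookup B)                              ≡⟨ ∣∣-sum B ⟨
  ∣ B ∣                                             ∎
  where open ≡-Reasoning

preserves-∈ : (g : Permutation′ v) {𝒳 : List (Subset v)} → Preserves g 𝒳 → ∀ {X} → X ∈ 𝒳 → image g X ∈ 𝒳
preserves-∈ g pres X∈ = Equivalence.to pres (∈-map⁺ (image g) X∈)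

closed⇒preserves : (g : Permutation′ v) {𝒳 : List (Subset v)} → (∀ {X} → X ∈ 𝒳 → image g X ∈ 𝒳) →
                   (∀ {X} → X ∈ 𝒳 → image (flip g) X ∈ 𝒳) → Preserves g 𝒳
closed⇒preserves g {𝒳} closed closed⁻¹ = mk⇔ to from
  where
  to : ∀ {X} → X ∈ map (image g) 𝒳 → X ∈ 𝒳
  to X∈ with Y , Y∈ , refl ← ∈-map⁻ (image g) X∈ = closed Y∈

  from : ∀ {X} → X ∈ 𝒳 → X ∈ map (image g) 𝒳
  from {X} X∈ = subst (_∈ map (image g) 𝒳) (image-flip g X) (∈-map⁺ (image g) (closed⁻¹ X∈))

-- The very expression counted in `Design.balanced`; on the diagonal it is the replication number,
-- the number of blocks on a point.
pairCount : List (Subset v) → Fin v → Fin v → ℕ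
pairCount 𝒳 x y = length (filter (λ B → (x ∈ˢ? B) ×-dec (y ∈ˢ? B)) 𝒳)

pairCount-∷ : (B : Subset v) (𝒳 : List (Subset v)) (x y : Fin v) →
              pairCount (B ∷ 𝒳) x y ≡ ind (lookup B x) * ind (lookup B y) + pairCount 𝒳 x y
pairCount-∷ B 𝒳 x y rewrite sym (∈?-lookup x B) | sym (∈?-lookup y B) with does (x ∈ˢ? B) | does (y ∈ˢ? B)
... | true  | true  = refl
... | true  | false = refl
... | false | _     = refl

pairCount-sym : (𝒳 : List (Subset v)) (x y : Fin v) → pairCount 𝒳 x y ≡ pairCount 𝒳 y x
pairCount-sym []      x y = refl
pairCount-sym (B ∷ 𝒳) x y = begin
  pairCount (B ∷ 𝒳) x y                                    ≡⟨ pairCount-∷ B 𝒳 x y ⟩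
  ind (lookup B x) * ind (lookup B y) + pairCount 𝒳 x y    ≡⟨ cong₂ _+_ (*-comm (ind (lookup B x)) _) (pairCount-sym 𝒳 x y) ⟩
  ind (lookup B y) * ind (lookup B x) + pairCount 𝒳 y x    ≡⟨ pairCount-∷ B 𝒳 y x ⟨
  pairCount (B ∷ 𝒳) y x                                    ∎
  where open ≡-Reasoning

pairCount-map : (g : Permutation′ v) (𝒳 : List (Subset v)) (x y : Fin v) →
                pairCount (map (image g) 𝒳) (g ⟨$⟩ʳ x) (g ⟨$⟩ʳ y) ≡ pairCount 𝒳 x y
pairCount-map g []      x y = refl
pairCount-map g (B ∷ 𝒳) x y = begin
  pairCount (image g B ∷ map (image g) 𝒳) (g ⟨$⟩ʳ x) (g ⟨$⟩ʳ y)
    ≡⟨ pairCount-∷ (image g B) (map (image g) 𝒳) (g ⟨$⟩ʳ x) (g ⟨$⟩ʳ y) ⟩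
  ind (lookup (image g B) (g ⟨$⟩ʳ x)) * ind (lookup (image g B) (g ⟨$⟩ʳ y)) + pairCount (map (image g) 𝒳) (g ⟨$⟩ʳ x) (g ⟨$⟩ʳ y)
    ≡⟨ cong₂ _+_ (cong₂ (λ a b → ind a * ind b) (lookup-image g B x) (lookup-image g B y)) (pairCount-map g 𝒳 x y) ⟩
  ind (lookup B x) * ind (lookup B y) + pairCount 𝒳 x y
    ≡⟨ pairCount-∷ B 𝒳 x y ⟨
  pairCount (B ∷ 𝒳) x y
    ∎
  where open ≡-Reasoning

-- The list and its image under `g` have the same members and no duplicates, so they are
-- rearrangements of each other and any count over them agrees.
pairCount-invariant : (g : Permutation′ v) (𝒳 : List (Subset v)) → Unique 𝒳 → Preserves g 𝒳 → ∀ x y →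
                      pairCount 𝒳 (g ⟨$⟩ʳ x) (g ⟨$⟩ʳ y) ≡ pairCount 𝒳 x y
pairCount-invariant g 𝒳 unique pres x y = trans
  (sym (↭-length (filter-↭ _ (∼bag⇒↭ (unique∧set⇒bag (map⁺ (image-injective g) unique) unique pres)))))
  (pairCount-map g 𝒳 x y)

pairCount-diagonal : {B : Subset v} {𝒳 : List (Subset v)} {x : Fin v} → B ∈ 𝒳 → x ∈ˢ B → 1 ≤ pairCount 𝒳 x x
pairCount-diagonal {B = B} {B′ ∷ 𝒳} {x} (here refl) x∈B =
  ≤-trans (m≤m+n 1 (pairCount 𝒳 x x)) (≤-reflexive (sym (trans (pairCount-∷ B 𝒳 x x)
    (cong (λ b → ind b * ind b + pairCount 𝒳 x x) ([]=⇒lookup x∈B)))))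
pairCount-diagonal {B = B} {B′ ∷ 𝒳} {x} (there B∈) x∈B =
  ≤-trans (pairCount-diagonal B∈ x∈B) (≤-trans (m≤n+m (pairCount 𝒳 x x) _) (≤-reflexive (sym (pairCount-∷ B′ 𝒳 x x))))

-- The standard chain transported along a relabelling of the points

module Relabelled (e : Vector ℕ s) (φ : Permutation′ (numPoints e)) where

  private
    N = numPoints e

  R : Fin (suc s) → Fin N → Fin N → Set
  R i x y = agree e i (φ ⟨$⟩ʳ x) (φ ⟨$⟩ʳ y)

  R? : ∀ i x y → Dec (R i x y)
  R? i x y = agree? e i (φ ⟨$⟩ʳ x) (φ ⟨$⟩ʳ y)

  near : Fin (suc s) → Subset N → Fin N → ℕ
  near i B x = sum (λ y → ind (lookup B y) * ind (does (R? i x y)))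

  Symmetry : Permutation′ N → Set
  Symmetry g = ∀ i x y → R i x y ⇔ R i (g ⟨$⟩ʳ x) (g ⟨$⟩ʳ y)

  symmetry-flip : ∀ {g} → Symmetry g → Symmetry (flip g)
  symmetry-flip {g} sy i x y = ⇔-sym (subst₂ (λ a b → R i (g ⟨$⟩ˡ x) (g ⟨$⟩ˡ y) ⇔ R i a b) (inverseʳ g) (inverseʳ g)
                                       (sy i (g ⟨$⟩ˡ x) (g ⟨$⟩ˡ y)))

  symmetries : PermutationGroup N
  symmetries = record
    { member    = Symmetry
    ; resp      = λ {g} {h} g≈h sy i x y → subst₂ (λ a b → R i x y ⇔ R i a b) (g≈h x) (g≈h y) (sy i x y)
    ; id-closed = λ i x y → ⇔-refl
    ; ∘-closed  = λ {g} {h} syg syh i x y → ⇔-trans (syg i x y) (syh i (g ⟨$⟩ʳ x) (g ⟨$⟩ʳ y))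
    ; ⁻¹-closed = λ {g} → symmetry-flip {g}
    }

  conjugate : Permutation′ N → Permutation′ N
  conjugate g = φ ∘ₚ (g ∘ₚ flip φ)

  conjugate-symmetry : ∀ {g} → Automorphism e g → Symmetry (conjugate g)
  conjugate-symmetry {g} aut i x y =
    subst₂ (λ a b → R i x y ⇔ agree e i a b) (sym (inverseʳ φ)) (sym (inverseʳ φ)) (aut i (φ ⟨$⟩ʳ x) (φ ⟨$⟩ʳ y))

  near-meet : ∀ i B x → near i B x ≡ meet e i (λ a → lookup B (φ ⟨$⟩ˡ a)) (φ ⟨$⟩ʳ x)
  near-meet i B x = sym (trans
    (sum-permute (λ a → ind (lookup B (φ ⟨$⟩ˡ a)) * ind (does (agree? e i (φ ⟨$⟩ʳ x) a))) φ)
    (sum-cong-≗ {N} (λ y → cong (λ z → ind (lookup B z) * ind (does (R? i x y))) (inverseˡ φ))))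

  near-image : ∀ {g} → Symmetry g → ∀ i B x → near i (image g B) (g ⟨$⟩ʳ x) ≡ near i B x
  near-image {g} sy i B x = trans
    (sum-permute (λ y → ind (lookup (image g B) y) * ind (does (R? i (g ⟨$⟩ʳ x) y))) g)
    (sum-cong-≗ {N} (λ y → cong₂ (λ a b → ind a * ind b) (lookup-image g B y)
      (does-⇔ (⇔-sym (sy i x y)) (R? i (g ⟨$⟩ʳ x) (g ⟨$⟩ʳ y)) (R? i x y))))

  near-top : ∀ B x → near (fromℕ s) B x ≡ ∣ B ∣
  near-top B x = trans (sum-cong-≗ {N} (λ y → trans
      (cong (λ b → ind (lookup B y) * ind b) (dec-true (R? (fromℕ s) x y) (agree-top e _ _)))
      (*-identityʳ _)))
    (sym (∣∣-sum B))

  ballSize : ∀ i x → sum (λ y → ind (does (R? i x y))) ≡ ∏ e i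
  ballSize i x = begin
    sum (λ y → ind (does (R? i x y)))                    ≡⟨ sum-permute (λ a → ind (does (agree? e i (φ ⟨$⟩ʳ x) a))) φ ⟨
    sum (λ a → ind (does (agree? e i (φ ⟨$⟩ʳ x) a)))     ≡⟨ sum-cong-≗ {N} (λ a → +-identityʳ _) ⟨
    meet e i (λ _ → true) (φ ⟨$⟩ʳ x)                     ≡⟨ classSize e i (φ ⟨$⟩ʳ x) ⟩
    ∏ e i                                                ∎
    where open ≡-Reasoning

  module _ (f : Vector ℕ s) where

    UniformIn : Subset N → Set
    UniformIn B = ∀ i x → x ∈ˢ B → near i B x ≡ ∏ f i

    uniformIn⇒uniform : ∀ {B} → UniformIn B → Uniform e f (λ a → lookup B (φ ⟨$⟩ˡ a))
    uniformIn⇒uniform {B} uni i a a∈ = begin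
      meet e i (λ b → lookup B (φ ⟨$⟩ˡ b)) a                     ≡⟨ cong (meet e i (λ b → lookup B (φ ⟨$⟩ˡ b))) (inverseʳ φ) ⟨
      meet e i (λ b → lookup B (φ ⟨$⟩ˡ b)) (φ ⟨$⟩ʳ (φ ⟨$⟩ˡ a))   ≡⟨ near-meet i B (φ ⟨$⟩ˡ a) ⟨
      near i B (φ ⟨$⟩ˡ a)                                        ≡⟨ uni i (φ ⟨$⟩ˡ a) (lookup⇒[]= _ B a∈) ⟩
      ∏ f i                                                      ∎
      where open ≡-Reasoning

    image-uniformIn : ∀ {g} → Symmetry g → ∀ {B} → UniformIn B → UniformIn (image g B)
    image-uniformIn {g} sy {B} uni i x x∈ = begin
      near i (image g B) x                        ≡⟨ cong (near i (image g B)) (inverseʳ g) ⟨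
      near i (image g B) (g ⟨$⟩ʳ (g ⟨$⟩ˡ x))      ≡⟨ near-image {g} sy i B (g ⟨$⟩ˡ x) ⟩
      near i B (g ⟨$⟩ˡ x)                         ≡⟨ uni i (g ⟨$⟩ˡ x) (lookup⇒[]= _ B (trans (sym (lookup∘tabulate _ x)) ([]=⇒lookup x∈))) ⟩
      ∏ f i                                       ∎
      where open ≡-Reasoning

    uniformIn-exists : (∀ j → f j ≤ e j) → (∀ j → 1 ≤ f j) → ∃[ B ] (UniformIn B × ∃[ x ] x ∈ˢ B)
    uniformIn-exists f≤e 1≤f = B₀ , uni , φ ⟨$⟩ˡ x₀ , lookup⇒[]= _ B₀ (trans (lookup-B₀ (φ ⟨$⟩ˡ x₀)) (trans (cong U (inverseʳ φ)) x₀∈))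
      where
      U  = uniformSet e f
      x₀ = proj₁ (uniformSet-nonempty e f f≤e 1≤f)
      x₀∈ = proj₂ (uniformSet-nonempty e f f≤e 1≤f)

      B₀ : Subset N
      B₀ = tabulate (λ x → U (φ ⟨$⟩ʳ x))

      lookup-B₀ : ∀ x → lookup B₀ x ≡ U (φ ⟨$⟩ʳ x)
      lookup-B₀ = lookup∘tabulate (λ x → U (φ ⟨$⟩ʳ x))

      uni : UniformIn B₀
      uni i x x∈ = begin
        near i B₀ x
          ≡⟨ near-meet i B₀ x ⟩
        meet e i (λ a → lookup B₀ (φ ⟨$⟩ˡ a)) (φ ⟨$⟩ʳ x)
          ≡⟨ sum-cong-≗ {N} (λ a → cong (λ b → ind b * ind (does (agree? e i (φ ⟨$⟩ʳ x) a))) (trans (lookup-B₀ (φ ⟨$⟩ˡ a)) (cong U (inverseʳ φ)))) ⟩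
        meet e i U (φ ⟨$⟩ʳ x)
          ≡⟨ uniformSet-uniform e f f≤e i (φ ⟨$⟩ʳ x) (trans (sym (lookup-B₀ x)) ([]=⇒lookup x∈)) ⟩
        ∏ f i
          ∎
        where open ≡-Reasoning

    flag-transitive : (∀ j → 1 ≤ f j) → ∀ {B B′ δ δ′} → UniformIn B → UniformIn B′ → δ ∈ˢ B → δ′ ∈ˢ B′ →
                      ∃[ g ] (Symmetry g × g ⟨$⟩ʳ δ ≡ δ′ × image g B ≡ B′)
    flag-transitive 1≤f {B} {B′} {δ} {δ′} uni uni′ δ∈ δ′∈
      with g , aut , gδ , gB ← uniform-transitive e f 1≤f (λ a → lookup B (φ ⟨$⟩ˡ a)) (λ a → lookup B′ (φ ⟨$⟩ˡ a))
             (uniformIn⇒uniform uni) (uniformIn⇒uniform uni′) {φ ⟨$⟩ʳ δ} {φ ⟨$⟩ʳ δ′}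
             (trans (cong (lookup B) (inverseˡ φ)) ([]=⇒lookup δ∈))
             (trans (cong (lookup B′) (inverseˡ φ)) ([]=⇒lookup δ′∈))
      = conjugate g , conjugate-symmetry {g} aut ,
        trans (cong (φ ⟨$⟩ˡ_) gδ) (inverseˡ φ) ,
        image-unique (conjugate g) {B} (λ x → trans (cong (lookup B) (sym (inverseˡ φ))) (gB (φ ⟨$⟩ʳ x)))

  sphere-transitive : ∀ j {x y z} → R (suc j) x y → ¬ R (inject₁ j) x y → R (suc j) x z → ¬ R (inject₁ j) x z →
                      ∃[ g ] (Symmetry g × g ⟨$⟩ʳ x ≡ x × g ⟨$⟩ʳ y ≡ z)
  sphere-transitive j x~y x≁y x~z x≁z with g , aut , gx , gy ← fixing-transitive e j x~y x≁y x~z x≁z =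
    conjugate g , conjugate-symmetry {g} aut ,
    trans (cong (φ ⟨$⟩ˡ_) gx) (inverseˡ φ) , trans (cong (φ ⟨$⟩ˡ_) gy) (inverseˡ φ)

  -- Both sides count the pairs of a block `B` on `x` and a point `y` of `B` in the level `i` class
  -- of `x`: on the left by `y`, on the right by `B`, each block contributing `c`.
  doubleCount : ∀ i (𝒳 : List (Subset N)) x c → (∀ {B} → B ∈ 𝒳 → x ∈ˢ B → near i B x ≡ c) →
                sum (λ y → pairCount 𝒳 x y * ind (does (R? i x y))) ≡ pairCount 𝒳 x x * c
  doubleCount i []      x c const = sum-zero {N} _ (λ _ → refl)
  doubleCount i (B ∷ 𝒳) x c const = begin
    sum (λ y → pairCount (B ∷ 𝒳) x y * r y)
      ≡⟨ sum-cong-≗ {N} (λ y → trans (cong (_* r y) (pairCount-∷ B 𝒳 x y)) (expand b (β y) (pairCount 𝒳 x y) (r y))) ⟩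
    sum (λ y → b * (β y * r y) + pairCount 𝒳 x y * r y)
      ≡⟨ ∑-distrib-+ {N} (λ y → b * (β y * r y)) (λ y → pairCount 𝒳 x y * r y) ⟩
    sum (λ y → b * (β y * r y)) + sum (λ y → pairCount 𝒳 x y * r y)
      ≡⟨ cong₂ _+_ (sym (*-distribˡ-sum {N} b (λ y → β y * r y))) (doubleCount i 𝒳 x c (const ∘ there)) ⟩
    b * near i B x + pairCount 𝒳 x x * c
      ≡⟨ cong (_+ pairCount 𝒳 x x * c) near≡ ⟩
    b * b * c + pairCount 𝒳 x x * c
      ≡⟨ *-distribʳ-+ c (b * b) (pairCount 𝒳 x x) ⟨
    (b * b + pairCount 𝒳 x x) * c
      ≡⟨ cong (_* c) (pairCount-∷ B 𝒳 x x) ⟨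
    pairCount (B ∷ 𝒳) x x * c
      ∎
    where
    open ≡-Reasoning
    b = ind (lookup B x)

    β r : Fin N → ℕ
    β y = ind (lookup B y)
    r y = ind (does (R? i x y))

    expand : ∀ b β p r → (b * β + p) * r ≡ b * (β * r) + p * r
    expand = solve 4 (λ b β p r → (b :* β :+ p) :* r := b :* (β :* r) :+ p :* r) refl
      where open +-*-Solver

    -- The square of the indicator is what the diagonal of `pairCount-∷` produces. A block that
    -- misses `x` contributes nothing to either side, so `const` is called only on blocks through
    -- `x`.
    near≡ : b * near i B x ≡ b * b * c
    near≡ with lookup B x in eq
    ... | false = refl
    ... | true  = cong (_+ 0) (const (here refl) (lookup⇒[]= x B eq))

-- Arithmetic of the intersection numbers

gcdPred∣ : (e : Vector ℕ s) (j : Fin s) → gcdPred e ∣ e j ∸ 1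
gcdPred∣ e zero    = gcd[m,n]∣m (e zero ∸ 1) _
gcdPred∣ e (suc j) = ∣-trans (gcd[m,n]∣n (e zero ∸ 1) _) (gcdPred∣ (e ∘ suc) j)

∣*gcdPred : ∀ {a} c (e : Vector ℕ s) → (∀ j → a ∣ c * (e j ∸ 1)) → a ∣ c * gcdPred e
∣*gcdPred {zero}  {a} c e a∣ = subst (a ∣_) (sym (*-zeroʳ c)) (a ∣0)
∣*gcdPred {suc s} {a} c e a∣ = subst (a ∣_) (sym (c*gcd[m,n]≡gcd[cm,cn] c (e zero ∸ 1) (gcdPred (e ∘ suc))))
  (gcd-greatest (a∣ zero) (∣*gcdPred c (e ∘ suc) (a∣ ∘ suc)))

∏-suc : (e : Vector ℕ s) (j : Fin s) → ∏ e (suc j) ≡ e j * ∏ e (inject₁ j)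
∏-suc e zero    = refl
∏-suc e (suc j) = begin
  e zero * ∏ (e ∘ suc) (suc j)                      ≡⟨ cong (e zero *_) (∏-suc (e ∘ suc) j) ⟩
  e zero * (e (suc j) * ∏ (e ∘ suc) (inject₁ j))    ≡⟨ *-swap (e zero) (e (suc j)) _ ⟩
  e (suc j) * (e zero * ∏ (e ∘ suc) (inject₁ j))    ∎
  where
  open ≡-Reasoning
  *-swap : ∀ a b c → a * (b * c) ≡ b * (a * c)
  *-swap = solve 3 (λ a b c → a :* (b :* c) := b :* (a :* c)) refl
    where open +-*-Solver

∏-pos : (e : Vector ℕ s) → (∀ j → 1 ≤ e j) → ∀ i → 1 ≤ ∏ e i
∏-pos         e 1≤e zero    = ≤-refl
∏-pos {suc s} e 1≤e (suc i) = *-mono-≤ (1≤e zero) (∏-pos (e ∘ suc) (1≤e ∘ suc) i)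

∏∣numPoints : (e : Vector ℕ s) (i : Fin (suc s)) → ∏ e i ∣ numPoints e
∏∣numPoints         e zero    = 1∣ numPoints e
∏∣numPoints {suc s} e (suc i) = *-monoʳ-∣ (e zero) (∏∣numPoints (e ∘ suc) i)

predProduct : ∀ {a c} → 1 ≤ a → 1 ≤ c → a * c ∸ 1 ≡ (c ∸ 1) + (a ∸ 1) * c
predProduct {suc a} {suc c} _ _ = refl

∏∸1-suc : (e : Vector ℕ s) → (∀ j → 1 ≤ e j) → ∀ j →
          ∏ e (suc j) ∸ 1 ≡ (∏ e (inject₁ j) ∸ 1) + (e j ∸ 1) * ∏ e (inject₁ j)
∏∸1-suc e 1≤e j = trans (cong (_∸ 1) (∏-suc e j)) (predProduct (1≤e j) (∏-pos e 1≤e (inject₁ j)))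

-- Every `e j` is 1 modulo `gcdPred e`, hence so is every partial product.
gcdPred∣∏∸1 : (e : Vector ℕ s) → (∀ j → 1 ≤ e j) → ∀ i → gcdPred e ∣ ∏ e i ∸ 1
gcdPred∣∏∸1 e 1≤e = <-weakInduction (λ i → gcdPred e ∣ ∏ e i ∸ 1) (gcdPred e ∣0) λ j ih →
  subst (gcdPred e ∣_) (sym (∏∸1-suc e 1≤e j)) (∣m∣n⇒∣m+n ih (∣m⇒∣m*n (∏ e (inject₁ j)) (gcdPred∣ e j)))

-- From the rational numbers `y` to natural numbers

toℚᵘ-/ : ∀ p q .{{_ : NonZero q}} → toℚᵘ (p ℚ./ q) ℚᵘ.≃ p ℚᵘ./ q
toℚᵘ-/ p (suc q) = toℚᵘ-fromℚᵘ (mkℚᵘ p q)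

-- The bridge from ℕ to ℚ: elsewhere `yᵢ` is represented by a natural number `m` satisfying the
-- equation cleared of the denominator `w`.
fraction-≡ : ∀ {m w K c} .{{_ : NonZero w}} → m * w ≡ w + K * c →
             1ℚ ℚ.+ (+ K ℚ./ w) ℚ.* (+ c ℚ./ 1) ≡ + m ℚ./ 1
fraction-≡ {m} {w@(suc w-1)} {K} {c} eq = toℚᵘ-injective (begin
  toℚᵘ (1ℚ ℚ.+ (+ K ℚ./ w) ℚ.* (+ c ℚ./ 1))
    ≈⟨ toℚᵘ-homo-+ 1ℚ ((+ K ℚ./ w) ℚ.* (+ c ℚ./ 1)) ⟩
  ℚᵘ.1ℚᵘ ℚᵘ.+ toℚᵘ ((+ K ℚ./ w) ℚ.* (+ c ℚ./ 1))
    ≈⟨ ℚᵘₚ.+-congʳ ℚᵘ.1ℚᵘ (toℚᵘ-homo-* (+ K ℚ./ w) (+ c ℚ./ 1)) ⟩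
  ℚᵘ.1ℚᵘ ℚᵘ.+ toℚᵘ (+ K ℚ./ w) ℚᵘ.* toℚᵘ (+ c ℚ./ 1)
    ≈⟨ ℚᵘₚ.+-congʳ ℚᵘ.1ℚᵘ (ℚᵘₚ.*-cong (toℚᵘ-/ (+ K) w) (toℚᵘ-/ (+ c) 1)) ⟩
  ℚᵘ.1ℚᵘ ℚᵘ.+ (+ K ℚᵘ./ w) ℚᵘ.* (+ c ℚᵘ./ 1)
    ≈⟨ *≡* crossMultiplied ⟩
  + m ℚᵘ./ 1
    ≈⟨ toℚᵘ-/ (+ m) 1 ⟨
  toℚᵘ (+ m ℚ./ 1)
    ∎)
  where
  open ℚᵘₚ.≃-Reasoning
  crossMultiplied : ((+ 1) ℤ.* + (w * 1) ℤ.+ (+ K ℤ.* + c) ℤ.* (+ 1)) ℤ.* (+ 1) ≡ + m ℤ.* + (1 * (w * 1))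
  crossMultiplied = ≡.begin
    (+ 1 ℤ.* + (w * 1) ℤ.+ (+ K ℤ.* + c) ℤ.* + 1) ℤ.* + 1   ≡.≡⟨ ℤₚ.*-identityʳ _ ⟩
    + 1 ℤ.* + (w * 1) ℤ.+ (+ K ℤ.* + c) ℤ.* + 1             ≡.≡⟨ cong₂ ℤ._+_ (ℤₚ.*-identityˡ (+ (w * 1))) (ℤₚ.*-identityʳ (+ K ℤ.* + c)) ⟩
    + (w * 1) ℤ.+ + K ℤ.* + c                               ≡.≡⟨ cong (λ x → + (w * 1) ℤ.+ x) (ℤₚ.pos-* K c) ⟨
    + (w * 1 + K * c)                                       ≡.≡⟨ cong (λ x → + (x + K * c)) (*-identityʳ w) ⟩
    + (w + K * c)                                           ≡.≡⟨ cong +_ eq ⟨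
    + (m * w)                                               ≡.≡⟨ cong (λ x → + (m * x)) (trans (*-identityˡ (w * 1)) (*-identityʳ w)) ⟨
    + (m * (1 * (w * 1)))                                   ≡.≡⟨ ℤₚ.pos-* m (1 * (w * 1)) ⟩
    + m ℤ.* + (1 * (w * 1))                                 ≡.∎
    where module ≡ = ≡-Reasoning

whole-injective : ∀ {m n} → + m ℚ./ 1 ≡ + n ℚ./ 1 → m ≡ n
whole-injective {m} {n} eq with *≡* p ← ℚᵘₚ.≃-trans (ℚᵘₚ.≃-sym (toℚᵘ-/ (+ m) 1)) (ℚᵘₚ.≃-trans (toℚᵘ-cong eq) (toℚᵘ-/ (+ n) 1))
  = ℤₚ.+-injective (trans (sym (ℤₚ.*-identityʳ (+ m))) (trans p (ℤₚ.*-identityʳ (+ n))))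

-- With q = (k - 1) d / (v - 1), the number yᵢ is 1 + q (∏ e i - 1) / d.
intersectionNumber : ∀ {m w K d q t} .{{_ : NonZero w}} → K * d ≡ q * w → m * w ≡ w + K * (t * d) → m ≡ 1 + q * t
intersectionNumber {m} {w} {K} {d} {q} {t} Kd≡qw eq = *-cancelʳ-≡ m (1 + q * t) w (begin
  m * w              ≡⟨ eq ⟩
  w + K * (t * d)    ≡⟨ cong (λ x → w + x) (rearrange K t d) ⟩
  w + K * d * t      ≡⟨ cong (λ z → w + z * t) Kd≡qw ⟩
  w + q * w * t      ≡⟨ factor w q t ⟩
  (1 + q * t) * w    ∎)
  where
  open ≡-Reasoning
  open +-*-Solver
  rearrange : ∀ K t d → K * (t * d) ≡ K * d * t
  rearrange = solve 3 (λ K t d → K :* (t :* d) := K :* d :* t) refl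

  factor : ∀ w q t → w + q * w * t ≡ (1 + q * t) * w
  factor = solve 3 (λ w q t → w :+ q :* w :* t := (con 1 :+ q :* t) :* w) refl

coprime-1+ : ∀ {m} q t → m ≡ 1 + q * t → Coprime m q
coprime-1+ q t refl {x} (d∣m , d∣q) = ∣1⇒≡1 (∣m+n∣m⇒∣n (subst (x ∣_) (+-comm 1 (q * t)) d∣m) (∣m⇒∣m*n t d∣q))

-- Conditions (FT1) and (FT2) against the intersection equation

module _ (k : ℕ) (e : Vector ℕ s) (1≤e : ∀ j → 1 ≤ e j)
         {{w≢0 : NonZero (numPoints e ∸ 1)}} {{d≢0 : NonZero (gcdPred e)}} where

  private
    w = numPoints e ∸ 1
    K = k ∸ 1
    d = gcdPred e

    suc-w : suc w ≡ numPoints e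
    suc-w = m+[n∸m]≡n (∏-pos e 1≤e (fromℕ _))

    t : Fin (suc s) → ℕ
    t i = quotient (gcdPred∣∏∸1 e 1≤e i)

    t-eq : ∀ i → ∏ e i ∸ 1 ≡ t i * d
    t-eq i = _∣_.equality (gcdPred∣∏∸1 e 1≤e i)

    -- The number that (FT2) asks yᵢ to divide. It is also the increment of `t`, so yᵢ grows by
    -- `q * z j` from one level to the next.
    z : Fin s → ℕ
    z j = (e j ∸ 1) * ∏ e (inject₁ j) / d

    z-eq : ∀ j → z j * d ≡ (e j ∸ 1) * ∏ e (inject₁ j)
    z-eq j = m/n*n≡m (∣m⇒∣m*n (∏ e (inject₁ j)) (gcdPred∣ e j))

    t-suc : ∀ j → t (suc j) ≡ t (inject₁ j) + z j
    t-suc j = *-cancelʳ-≡ (t (suc j)) (t (inject₁ j) + z j) d (begin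
      t (suc j) * d                                                    ≡⟨ t-eq (suc j) ⟨
      ∏ e (suc j) ∸ 1                                                  ≡⟨ ∏∸1-suc e 1≤e j ⟩
      (∏ e (inject₁ j) ∸ 1) + (e j ∸ 1) * ∏ e (inject₁ j)              ≡⟨ cong₂ _+_ (t-eq (inject₁ j)) (sym (z-eq j)) ⟩
      t (inject₁ j) * d + z j * d                                      ≡⟨ *-distribʳ-+ d (t (inject₁ j)) (z j) ⟨
      (t (inject₁ j) + z j) * d                                        ∎)
      where open ≡-Reasoning

  y-≡ : ∀ {m} i → m * w ≡ w + K * (∏ e i ∸ 1) → y k e i ≡ + m ℚ./ 1
  y-≡ {m} i = fraction-≡ {m} {w} {K} {∏ e i ∸ 1}

  module Necessary (Y : Fin (suc s) → ℕ) (Y-pos : ∀ i → 1 ≤ Y i)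
                   (Y-eq : ∀ i → Y i * w ≡ w + K * (∏ e i ∸ 1))
                   (Y-∣ : ∀ j → Y (inject₁ j) ∣ Y (suc j)) where

    -- Subtracting `Y-eq` at two consecutive levels shows that `w` divides
    -- `K * (e j ∸ 1) * ∏ e (inject₁ j)`. The last factor divides `w + 1`, so it is coprime to `w`
    -- and drops out; the gcd over all `j` remains.
    ft1 : FT1 k e
    ft1 = ∣*gcdPred K e λ j → coprime-divisor (coprime j) (subst (w ∣_) (rearrange K (e j ∸ 1) (∏ e (inject₁ j))) (w∣ j))
      where
      rearrange : ∀ K a c → K * (a * c) ≡ c * (K * a)
      rearrange = solve 3 (λ K a c → K :* (a :* c) := c :* (K :* a)) refl
        where open +-*-Solver

      coprime : ∀ j → Coprime w (∏ e (inject₁ j))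
      coprime j {x} (x∣w , x∣c) = ∣1⇒≡1 (∣m+n∣m⇒∣n (subst (x ∣_) (trans (sym suc-w) (+-comm 1 w)) (∣-trans x∣c (∏∣numPoints e (inject₁ j)))) x∣w)

      w∣K : ∀ i → w ∣ K * (∏ e i ∸ 1)
      w∣K i = ∣m+n∣m⇒∣n (subst (w ∣_) (Y-eq i) (n∣m*n (Y i))) ∣-refl

      w∣ : ∀ j → w ∣ K * ((e j ∸ 1) * ∏ e (inject₁ j))
      w∣ j = ∣m+n∣m⇒∣n (subst (w ∣_) (trans (cong (K *_) (∏∸1-suc e 1≤e j)) (*-distribˡ-+ K _ _)) (w∣K (suc j))) (w∣K (inject₁ j))

    private
      q : ℕ
      q = quotient ft1

      Y-q : ∀ i → Y i ≡ 1 + q * t i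
      Y-q i = intersectionNumber {K = K} {d} {q} {t i} (_∣_.equality ft1) (trans (Y-eq i) (cong (λ x → w + K * x) (t-eq i)))

      Y-suc : ∀ j → Y (suc j) ≡ Y (inject₁ j) + q * z j
      Y-suc j = begin
        Y (suc j)                          ≡⟨ Y-q (suc j) ⟩
        1 + q * t (suc j)                  ≡⟨ cong (λ x → 1 + q * x) (t-suc j) ⟩
        1 + q * (t (inject₁ j) + z j)      ≡⟨ cong suc (*-distribˡ-+ q (t (inject₁ j)) (z j)) ⟩
        1 + q * t (inject₁ j) + q * z j    ≡⟨ cong (_+ q * z j) (Y-q (inject₁ j)) ⟨
        Y (inject₁ j) + q * z j            ∎
        where open ≡-Reasoning

    -- `Y (inject₁ j)` divides the next `Y`, hence the increment `q * z j`. Being 1 modulo `q`, it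
    -- divides `z j`.
    ft2 : FT2 k e
    ft2 j _ = Y (inject₁ j) , y-≡ {Y (inject₁ j)} (inject₁ j) (Y-eq (inject₁ j)) , Y-pos (inject₁ j) ,
      coprime-divisor {o = z j} (coprime-1+ q (t (inject₁ j)) (Y-q (inject₁ j))) (∣m+n∣m⇒∣n (subst (Y (inject₁ j) ∣_) (Y-suc j) (Y-∣ j)) ∣-refl)

  module Sufficient (K≤w : K ≤ w) (ft1 : FT1 k e) (ft2 : FT2 k e) where

    private
      q : ℕ
      q = quotient ft1

      Kd≡qw : K * d ≡ q * w
      Kd≡qw = _∣_.equality ft1

      -- Built from the quotient `q` of (FT1), so that the levels `0` and `s` are covered as well;
      -- `Y-z` identifies it with the `m` of (FT2).
      Y : Fin (suc s) → ℕ
      Y i = 1 + q * t i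

      Y-eq : ∀ i → Y i * w ≡ w + K * (∏ e i ∸ 1)
      Y-eq i = begin
        (1 + q * t i) * w        ≡⟨ expand q (t i) w ⟩
        w + q * w * t i          ≡⟨ cong (λ x → w + x * t i) Kd≡qw ⟨
        w + K * d * t i          ≡⟨ cong (λ x → w + x) (rearrange K d (t i)) ⟩
        w + K * (t i * d)        ≡⟨ cong (λ x → w + K * x) (t-eq i) ⟨
        w + K * (∏ e i ∸ 1)      ∎
        where
        open ≡-Reasoning
        open +-*-Solver
        expand : ∀ q t w → (1 + q * t) * w ≡ w + q * w * t
        expand = solve 3 (λ q t w → (con 1 :+ q :* t) :* w := w :+ q :* w :* t) refl

        rearrange : ∀ K d t → K * d * t ≡ K * (t * d)
        rearrange = solve 3 (λ K d t → K :* d :* t := K :* (t :* d)) refl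

      Y-suc : ∀ j → Y (suc j) ≡ Y (inject₁ j) + q * z j
      Y-suc j = cong suc (trans (cong (q *_) (t-suc j)) (*-distribˡ-+ q (t (inject₁ j)) (z j)))

      t-zero : t zero ≡ 0
      t-zero = m*n≡0⇒m≡0 (t zero) d (sym (t-eq zero))

      Y-zero : Y zero ≡ 1
      Y-zero = cong suc (trans (cong (q *_) t-zero) (*-zeroʳ q))

      Y-z : ∀ j → Y (inject₁ j) ∣ z j
      -- (FT2) begins at level 1; at level 0 the divisor is 1.
      Y-z zero      = subst (_∣ z zero) (sym Y-zero) (1∣ z zero)
      Y-z j@(suc _) with m , y≡m , _ , m∣z ← ft2 j (s≤s z≤n) =
        subst (_∣ z j) (whole-injective {m} {Y (inject₁ j)} (trans (sym y≡m) (y-≡ {Y (inject₁ j)} (inject₁ j) (Y-eq (inject₁ j))))) m∣z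

      Y-∣ : ∀ j → Y (inject₁ j) ∣ Y (suc j)
      Y-∣ j = subst (Y (inject₁ j) ∣_) (sym (Y-suc j)) (∣m∣n⇒∣m+n ∣-refl (∣n⇒∣m*n q (Y-z j)))

      q≤d : q ≤ d
      q≤d = *-cancelʳ-≤ q d w (≤-trans (≤-reflexive (sym Kd≡qw)) (≤-trans (*-monoˡ-≤ d K≤w) (≤-reflexive (*-comm w d))))

      -- After multiplication by `d` the right side exceeds the left by `(e j ∸ 1) * (d ∸ q)`, so
      -- the claim rests on `q ≤ d`, which comes from `K ≤ w`.
      Y-≤ : ∀ j → Y (suc j) ≤ e j * Y (inject₁ j)
      Y-≤ j = *-cancelʳ-≤ (Y (suc j)) (e j * Y (inject₁ j)) d (begin
        Y (suc j) * d                                 ≡⟨ cong (_* d) (Y-suc j) ⟩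
        (Y₀ + q * z j) * d                            ≡⟨ expand Y₀ q (z j) d ⟩
        Y₀ * d + q * (z j * d)                        ≡⟨ cong (λ x → Y₀ * d + q * x) (z-eq j) ⟩
        Y₀ * d + q * (a * c)                          ≡⟨ cong (λ x → Y₀ * d + q * (a * x)) suc-c ⟨
        Y₀ * d + q * (a * suc (c ∸ 1))                ≡⟨ rearrange₁ Y₀ d q a (c ∸ 1) ⟩
        Y₀ * d + a * (q + q * (c ∸ 1))                ≤⟨ +-monoʳ-≤ (Y₀ * d) (*-monoʳ-≤ a (+-monoˡ-≤ (q * (c ∸ 1)) q≤d)) ⟩
        Y₀ * d + a * (d + q * (c ∸ 1))                ≡⟨ cong (λ x → Y₀ * d + a * (d + q * x)) (t-eq (inject₁ j)) ⟩
        Y₀ * d + a * (d + q * (t (inject₁ j) * d))    ≡⟨ rearrange₂ d a q (t (inject₁ j)) ⟩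
        suc a * Y₀ * d                                ≡⟨ cong (λ x → x * Y₀ * d) (m+[n∸m]≡n (1≤e j)) ⟩
        e j * Y₀ * d                                  ∎)
        where
        open ≤-Reasoning
        Y₀ = Y (inject₁ j)
        a = e j ∸ 1
        c = ∏ e (inject₁ j)

        suc-c : suc (c ∸ 1) ≡ c
        suc-c = m+[n∸m]≡n (∏-pos e 1≤e (inject₁ j))

        open +-*-Solver
        expand : ∀ Y q z d → (Y + q * z) * d ≡ Y * d + q * (z * d)
        expand = solve 4 (λ Y q z d → (Y :+ q :* z) :* d := Y :* d :+ q :* (z :* d)) refl

        rearrange₁ : ∀ Y d q a c → Y * d + q * (a * suc c) ≡ Y * d + a * (q + q * c)
        rearrange₁ = solve 5 (λ Y d q a c → Y :* d :+ q :* (a :* (con 1 :+ c)) := Y :* d :+ a :* (q :+ q :* c)) refl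

        rearrange₂ : ∀ d a q t → (1 + q * t) * d + a * (d + q * (t * d)) ≡ (suc a * (1 + q * t)) * d
        rearrange₂ = solve 4 (λ d a q t → (con 1 :+ q :* t) :* d :+ a :* (d :+ q :* (t :* d)) := ((con 1 :+ a) :* (con 1 :+ q :* t)) :* d) refl

    f : Vector ℕ s
    f j = quotient (Y-∣ j)

    private
      f-eq : ∀ j → Y (suc j) ≡ f j * Y (inject₁ j)
      f-eq j = _∣_.equality (Y-∣ j)

      ∏f≡Y : ∀ i → ∏ f i ≡ Y i
      ∏f≡Y = <-weakInduction (λ i → ∏ f i ≡ Y i) (sym Y-zero) λ j ih →
        trans (∏-suc f j) (trans (cong (f j *_) ih) (sym (f-eq j)))

    f≤e : ∀ j → f j ≤ e j
    f≤e j = *-cancelʳ-≤ (f j) (e j) (Y (inject₁ j)) (≤-trans (≤-reflexive (sym (f-eq j))) (Y-≤ j))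

    1≤f : ∀ j → 1 ≤ f j
    -- A zero `f j` would make `Y (suc j)`, a successor, equal to 0.
    1≤f j with f j | f-eq j
    ... | suc _ | _ = s≤s z≤n

    ∏f-eq : ∀ i → ∏ f i * w ≡ w + K * (∏ e i ∸ 1)
    ∏f-eq i = trans (cong (_* w) (∏f≡Y i)) (Y-eq i)

-- Flag-transitive designs and uniform designs

allSubsets : ∀ n → List (Subset n)
allSubsets zero    = [] ∷ []
allSubsets (suc n) = map (true ∷_) (allSubsets n) ++ map (false ∷_) (allSubsets n)

allSubsets-complete : (B : Subset n) → B ∈ allSubsets n
allSubsets-complete []          = here refl
allSubsets-complete (true  ∷ B) = ∈-++⁺ˡ (∈-map⁺ (true ∷_) (allSubsets-complete B))
allSubsets-complete (false ∷ B) = ∈-++⁺ʳ (map (true ∷_) (allSubsets _)) (∈-map⁺ (false ∷_) (allSubsets-complete B))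

allSubsets-unique : ∀ n → Unique (allSubsets n)
allSubsets-unique zero    = [] ∷ []
allSubsets-unique (suc n) = ++⁺ (map⁺ ∷-injectiveʳ (allSubsets-unique n)) (map⁺ ∷-injectiveʳ (allSubsets-unique n)) disjoint
  where
  disjoint : ∀ {B} → ¬ (B ∈ map (true ∷_) (allSubsets n) × B ∈ map (false ∷_) (allSubsets n))
  disjoint (p , q) with _ , _ , refl ← ∈-map⁻ (true ∷_) p with () ← proj₂ (proj₂ (∈-map⁻ (false ∷_) q))

nonempty-of-size : (B : Subset n) → ∣ B ∣ ≢ 0 → ∃[ x ] x ∈ˢ B
nonempty-of-size B ∣B∣≢0 with x , Bx ← sum≢0⇒term≢0 (ind ∘ lookup B) (∣B∣≢0 ∘ trans (∣∣-sum B)) =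
  x , lookup⇒[]= x B (ind-true Bx)

ind-split : ∀ {P Q : Set} (p? : Dec P) (q? : Dec Q) → (P → Q) →
            ind (does q?) ≡ ind (does p?) + ind (does q? ∧ not (does p?))
ind-split (yes p) (yes q) _   = refl
ind-split (yes p) (no ¬q) p⇒q = contradiction (p⇒q p) ¬q
ind-split (no ¬p) (yes q) _   = refl
ind-split (no ¬p) (no ¬q) _   = refl

ind-difference : ∀ {P Q : Set} (p? : Dec P) (q? : Dec Q) {a b} → (¬ P → Q → a ≡ b) →
                 a * ind (does q? ∧ not (does p?)) ≡ b * ind (does q? ∧ not (does p?))
ind-difference (yes p) (yes q) {a} {b} _   = trans (*-zeroʳ a) (sym (*-zeroʳ b))
ind-difference (yes p) (no ¬q) {a} {b} _   = trans (*-zeroʳ a) (sym (*-zeroʳ b))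
ind-difference (no ¬p) (yes q)         a≡b = cong (_* 1) (a≡b ¬p q)
ind-difference (no ¬p) (no ¬q) {a} {b} _   = trans (*-zeroʳ a) (sym (*-zeroʳ b))

-- Partition chains in relabelled form

module _ {e : Vector ℕ s} (ch : PartitionChain e) where

  private
    N = numPoints e
    φ = proj₁ (standardise ch)

  open Relabelled e φ

  class-R : ∀ i {X x} → X ∈ classes (𝒞 ch i) → x ∈ˢ X → ∀ y → y ∈ˢ X ⇔ R i x y
  class-R = proj₂ (standardise ch)

  symmetry-preserves : ∀ {g} → Symmetry g → ∀ i → Preserves g (classes (𝒞 ch i))
  symmetry-preserves {g} sy i = closed⇒preserves g (closed {g} sy) (closed {flip g} (symmetry-flip {g} sy))
    where
    closed : ∀ {g} → Symmetry g → ∀ {X} → X ∈ classes (𝒞 ch i) → image g X ∈ classes (𝒞 ch i)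
    closed {g} sy {X} X∈ with x , x∈X ← Partition.nonempty (𝒞 ch i) X∈ =
      subst (_∈ classes (𝒞 ch i)) (sym (image-unique g {X} {Z} same)) (classOf-∈ (𝒞 ch i) (g ⟨$⟩ʳ x))
      where
      Z = classOf (𝒞 ch i) (g ⟨$⟩ʳ x)

      same : ∀ y → lookup X y ≡ lookup Z (g ⟨$⟩ʳ y)
      same y = begin
        lookup X y                     ≡⟨ ∈?-lookup y X ⟨
        does (y ∈ˢ? X)                 ≡⟨ does-⇔ (⇔-trans (class-R i X∈ x∈X y) (⇔-trans (sy i x y)
                                            (⇔-sym (class-R i (classOf-∈ (𝒞 ch i) (g ⟨$⟩ʳ x)) (∈-classOf (𝒞 ch i) (g ⟨$⟩ʳ x)) (g ⟨$⟩ʳ y)))))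
                                            (y ∈ˢ? X) (g ⟨$⟩ʳ y ∈ˢ? Z) ⟩
        does (g ⟨$⟩ʳ y ∈ˢ? Z)          ≡⟨ ∈?-lookup (g ⟨$⟩ʳ y) Z ⟩
        lookup Z (g ⟨$⟩ʳ y)            ∎
        where open ≡-Reasoning

  preserves-R : ∀ {g} i → Preserves g (classes (𝒞 ch i)) → ∀ {x y} → R i x y → R i (g ⟨$⟩ʳ x) (g ⟨$⟩ʳ y)
  preserves-R {g} i pres {x} {y} x~y =
    Equivalence.to (class-R i (preserves-∈ g pres (classOf-∈ (𝒞 ch i) x)) (∈-image g (∈-classOf (𝒞 ch i) x)) (g ⟨$⟩ʳ y))
      (∈-image g (Equivalence.from (class-R i (classOf-∈ (𝒞 ch i) x) (∈-classOf (𝒞 ch i) x) y) x~y))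

  preserves-symmetry : ∀ {g} → (∀ i → Preserves g (classes (𝒞 ch i))) → (∀ i → Preserves (flip g) (classes (𝒞 ch i))) →
                       Symmetry g
  preserves-symmetry {g} pres pres⁻¹ i x y =
    mk⇔ (preserves-R {g} i (pres i)) (λ gx~gy → subst₂ (R i) (inverseˡ g) (inverseˡ g) (preserves-R {flip g} i (pres⁻¹ i) gx~gy))

  ∣∩∣-near : ∀ i {B C x} → C ∈ classes (𝒞 ch i) → x ∈ˢ C → ∣ B ∩ C ∣ ≡ near i B x
  ∣∩∣-near i {B} {C} {x} C∈ x∈C = trans (∣∣-sum (B ∩ C)) (sum-cong-≗ {N} pointwise)
    where
    ind-∧ : ∀ a b → ind (a ∧ b) ≡ ind a * ind b
    ind-∧ true  b = sym (+-identityʳ (ind b))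
    ind-∧ false b = refl

    pointwise : ∀ y → ind (lookup (B ∩ C) y) ≡ ind (lookup B y) * ind (does (R? i x y))
    pointwise y = begin
      ind (lookup (B ∩ C) y)                       ≡⟨ cong ind (lookup-zipWith _∧_ y B C) ⟩
      ind (lookup B y ∧ lookup C y)                ≡⟨ ind-∧ (lookup B y) (lookup C y) ⟩
      ind (lookup B y) * ind (lookup C y)          ≡⟨ cong (λ b → ind (lookup B y) * ind b) (∈?-lookup y C) ⟨
      ind (lookup B y) * ind (does (y ∈ˢ? C))      ≡⟨ cong (λ b → ind (lookup B y) * ind b) (does-⇔ (class-R i C∈ x∈C y) (y ∈ˢ? C) (R? i x y)) ⟩
      ind (lookup B y) * ind (does (R? i x y))     ∎
      where open ≡-Reasoning

  module _ {k : ℕ} (2≤k : 2 ≤ k) (1≤e : ∀ j → 1 ≤ e j) {{w≢0 : NonZero (numPoints e ∸ 1)}} where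

    private
      w = numPoints e ∸ 1
      K = k ∸ 1

      1≤∏e : ∀ i → 1 ≤ ∏ e i
      1≤∏e = ∏-pos e 1≤e

      suc-w : suc w ≡ numPoints e
      suc-w = m+[n∸m]≡n (1≤∏e (fromℕ s))

      suc-K : suc K ≡ k
      suc-K = m+[n∸m]≡n (<⇒≤ 2≤k)

    -- Intersection numbers of a flag-transitive design

    module FlagTransitiveDesign {l : ℕ} (𝒟 : Design N k l) (aft : AdmitsFlagTransitive ch 𝒟) where

      private
        G = proj₁ aft
        flagTransitive = proj₁ (proj₂ (proj₂ aft))
        preserving = proj₂ (proj₂ (proj₂ aft))

        member-symmetry : ∀ {g} → member G g → Symmetry g
        member-symmetry {g} g∈ = preserves-symmetry {g} (preserving g∈) (preserving (PermutationGroup.⁻¹-closed G g∈))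

        near-flag : ∀ i {δ B δ′ B′} → B ∈ blocks 𝒟 → δ ∈ˢ B → B′ ∈ blocks 𝒟 → δ′ ∈ˢ B′ → near i B′ δ′ ≡ near i B δ
        near-flag i {δ} {B} B∈ δ∈B B′∈ δ′∈B′ with flagTransitive B∈ δ∈B B′∈ δ′∈B′
        ... | g , g∈ , refl , refl = near-image {g} (member-symmetry g∈) i B δ

        B₀ = proj₁ (Design.nonempty 𝒟)
        B₀∈ = proj₂ (Design.nonempty 𝒟)

        flag : ∃[ x ] x ∈ˢ B₀
        flag = nonempty-of-size B₀ (λ eq → <⇒≢ (<⇒≤ 2≤k) (trans (sym eq) (Design.blockSize 𝒟 B₀∈)))

        δ₀ = proj₁ flag
        δ₀∈ = proj₂ flag

        r = pairCount (blocks 𝒟) δ₀ δ₀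

        r≢0 : NonZero r
        r≢0 = >-nonZero (pairCount-diagonal B₀∈ δ₀∈)

        at-δ₀ : Fin N → ℕ
        at-δ₀ y = ind (does (δ₀ ≟ y))

        sum-at-δ₀ : ∀ c → sum (λ y → c * at-δ₀ y) ≡ c
        sum-at-δ₀ c = begin
          sum (λ y → c * at-δ₀ y)   ≡⟨ sum-supported-at δ₀ _ (λ y y≢ → trans (cong (λ b → c * ind b) (dec-false (δ₀ ≟ y) (y≢ ∘ sym))) (*-zeroʳ c)) ⟩
          c * at-δ₀ δ₀              ≡⟨ cong (λ b → c * ind b) (dec-true (δ₀ ≟ δ₀) refl) ⟩
          c * 1                     ≡⟨ *-identityʳ c ⟩
          c                         ∎
          where open ≡-Reasoning

      Y : Fin (suc s) → ℕ
      Y i = near i B₀ δ₀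

      near-Y : ∀ i {B x} → B ∈ blocks 𝒟 → x ∈ˢ B → near i B x ≡ Y i
      near-Y i = near-flag i B₀∈ δ₀∈

      private
        -- Over the class of `δ₀` the pair count is `l` except at `δ₀` itself, where it is `r`. The
        -- exceptional term is balanced by adding `l` on one side and `r` on the other, which avoids
        -- subtraction.
        countFlags : ∀ i → r * Y i + l ≡ r + l * ∏ e i
        countFlags i = begin
          r * Y i + l
            ≡⟨ cong₂ _+_ (doubleCount i (blocks 𝒟) δ₀ (Y i) (near-Y i)) (sum-at-δ₀ l) ⟨
          sum (λ y → P y * ρ y) + sum (λ y → l * at-δ₀ y)
            ≡⟨ ∑-distrib-+ {N} (λ y → P y * ρ y) (λ y → l * at-δ₀ y) ⟨
          sum (λ y → P y * ρ y + l * at-δ₀ y)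
            ≡⟨ sum-cong-≗ {N} pointwise ⟩
          sum (λ y → r * at-δ₀ y + l * ρ y)
            ≡⟨ ∑-distrib-+ {N} (λ y → r * at-δ₀ y) (λ y → l * ρ y) ⟩
          sum (λ y → r * at-δ₀ y) + sum (λ y → l * ρ y)
            ≡⟨ cong₂ _+_ (sum-at-δ₀ r) (trans (sym (*-distribˡ-sum {N} l ρ)) (cong (l *_) (ballSize i δ₀))) ⟩
          r + l * ∏ e i
            ∎
          where
          open ≡-Reasoning
          P ρ : Fin N → ℕ
          P y = pairCount (blocks 𝒟) δ₀ y
          ρ y = ind (does (R? i δ₀ y))

          pointwise : ∀ y → P y * ρ y + l * at-δ₀ y ≡ r * at-δ₀ y + l * ρ y
          pointwise y with δ₀ ≟ y
          ... | yes refl = trans (cong (λ a → r * a + l * 1) ρ≡1) (cong (λ a → r * 1 + l * a) (sym ρ≡1))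
            where
            ρ≡1 : ρ δ₀ ≡ 1
            ρ≡1 = cong ind (dec-true (R? i δ₀ δ₀) (agree-refl e i))
          ... | no δ₀≢y = begin
            P y * ρ y + l * 0    ≡⟨ cong (λ a → P y * ρ y + a) (*-zeroʳ l) ⟩
            P y * ρ y + 0        ≡⟨ +-identityʳ _ ⟩
            P y * ρ y            ≡⟨ cong (_* ρ y) (Design.balanced 𝒟 δ₀≢y) ⟩
            l * ρ y              ≡⟨ cong (_+ l * ρ y) (*-zeroʳ r) ⟨
            r * 0 + l * ρ y      ∎

        rY : ∀ i → r * Y i ≡ r + l * (∏ e i ∸ 1)
        rY i = +-cancelʳ-≡ l _ _ (begin
          r * Y i + l                       ≡⟨ countFlags i ⟩
          r + l * ∏ e i                     ≡⟨ cong (λ c → r + l * c) (m+[n∸m]≡n (1≤∏e i)) ⟨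
          r + l * suc (∏ e i ∸ 1)           ≡⟨ rearrange r l (∏ e i ∸ 1) ⟩
          r + l * (∏ e i ∸ 1) + l           ∎)
          where
          open ≡-Reasoning
          rearrange : ∀ r l c → r + l * suc c ≡ r + l * c + l
          rearrange = solve 3 (λ r l c → r :+ l :* (con 1 :+ c) := r :+ l :* c :+ l) refl
            where open +-*-Solver

        -- The case `i = s` of `rY`, where `Y` is `k`: the classical relation r (k - 1) = λ (v - 1).
        rK : r * K ≡ l * w
        rK = +-cancelˡ-≡ r _ _ (begin
          r + r * K          ≡⟨ *-suc r K ⟨
          r * suc K          ≡⟨ cong (r *_) (trans suc-K (sym (trans (near-top B₀ δ₀) (Design.blockSize 𝒟 B₀∈)))) ⟩
          r * Y (fromℕ s)    ≡⟨ rY (fromℕ s) ⟩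
          r + l * w          ∎)
          where open ≡-Reasoning

      -- Multiplying `rY` by `w` and trading `l * w` for `r * K` leaves the positive factor `r` on
      -- both sides, so the parameters r and λ disappear.
      Y-eq : ∀ i → Y i * w ≡ w + K * (∏ e i ∸ 1)
      Y-eq i = *-cancelˡ-≡ _ _ r {{r≢0}} (begin
        r * (Y i * w)          ≡⟨ *-assoc r (Y i) w ⟨
        r * Y i * w            ≡⟨ cong (_* w) (rY i) ⟩
        (r + l * c) * w        ≡⟨ rearrange r l c w ⟩
        r * w + l * w * c      ≡⟨ cong (λ x → r * w + x * c) rK ⟨
        r * w + r * K * c      ≡⟨ factor r w K c ⟩
        r * (w + K * c)        ∎)
        where
        open ≡-Reasoning
        open +-*-Solver
        c = ∏ e i ∸ 1
        rearrange : ∀ r l c w → (r + l * c) * w ≡ r * w + l * w * c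
        rearrange = solve 4 (λ r l c w → (r :+ l :* c) :* w := r :* w :+ l :* w :* c) refl

        factor : ∀ r w K c → r * w + r * K * c ≡ r * (w + K * c)
        factor = solve 4 (λ r w K c → r :* w :+ r :* K :* c := r :* (w :+ K :* c)) refl

      Y-pos : ∀ i → 1 ≤ Y i
      Y-pos i = n≢0⇒n>0 (λ Y≡0 → ≢-nonZero⁻¹ w (m+n≡0⇒m≡0 w (trans (sym (Y-eq i)) (cong (_* w) Y≡0))))

      Y-∣ : ∀ j → Y (inject₁ j) ∣ Y (suc j)
      Y-∣ j = subst₂ _∣_ (sym (near-meet (inject₁ j) B₀ δ₀)) (sym (near-meet (suc j) B₀ δ₀))
        (meet-∣ e B regular j (φ ⟨$⟩ʳ δ₀) (trans (cong (lookup B₀) (inverseˡ φ)) ([]=⇒lookup δ₀∈)))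
        where
        B : Fin N → Bool
        B a = lookup B₀ (φ ⟨$⟩ˡ a)

        meet≡Y : ∀ i a → B a ≡ true → meet e i B a ≡ Y i
        meet≡Y i a Ba = begin
          meet e i B a                        ≡⟨ cong (meet e i B) (inverseʳ φ) ⟨
          meet e i B (φ ⟨$⟩ʳ (φ ⟨$⟩ˡ a))      ≡⟨ near-meet i B₀ (φ ⟨$⟩ˡ a) ⟨
          near i B₀ (φ ⟨$⟩ˡ a)                ≡⟨ near-Y i B₀∈ (lookup⇒[]= _ B₀ Ba) ⟩
          Y i                                 ∎
          where open ≡-Reasoning

        regular : Regular e B
        regular i a b Ba Bb = trans (meet≡Y i a Ba) (sym (meet≡Y i b Bb))

      intersection : ∀ i {C B} → C ∈ classes (𝒞 ch i) → B ∈ blocks 𝒟 → ∣ B ∩ C ∣ ≡ 0 ⊎ ∣ B ∩ C ∣ ≡ Y i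
      intersection i {C} {B} C∈ B∈ with ∣ B ∩ C ∣ ℕ.≟ 0
      ... | yes ≡0 = inj₁ ≡0
      ... | no  ≢0 with x , x∈ ← nonempty-of-size (B ∩ C) ≢0 with x∈B , x∈C ← x∈p∩q⁻ B C x∈ =
        inj₂ (trans (∣∩∣-near i {B} C∈ x∈C) (near-Y i B∈ x∈B))

    -- Pair counts in a family invariant under all symmetries

    module PairCounts (𝒳 : List (Subset N)) (unique : Unique 𝒳) (preserves : {g : Permutation′ N} → Symmetry g → Preserves g 𝒳)
                      (Y : Fin (suc s) → ℕ) (Y-eq : ∀ i → Y i * w ≡ w + K * (∏ e i ∸ 1))
                      (near-Y : (i : Fin (suc s)) {B : Subset N} {x : Fin N} → B ∈ 𝒳 → x ∈ˢ B → near i B x ≡ Y i) where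

      M : Fin N → Fin N → ℕ
      M = pairCount 𝒳

      M-sphere : ∀ j {x y z} → R (suc j) x y → ¬ R (inject₁ j) x y → R (suc j) x z → ¬ R (inject₁ j) x z → M x z ≡ M x y
      M-sphere j {x} {y} x~y x≁y x~z x≁z with sphere-transitive j x~y x≁y x~z x≁z
      ... | g , sy , gx≡x , refl =
        trans (cong (λ a → M a (g ⟨$⟩ʳ y)) (sym gx≡x)) (pairCount-invariant g 𝒳 unique (preserves {g} sy) x y)

      module Sphere (j : Fin s) {x x′ : Fin N} (x~x′ : R (suc j) x x′) (x≁x′ : ¬ R (inject₁ j) x x′) where

        ρ₀ ρ₁ D : Fin N → ℕ
        ρ₀ y = ind (does (R? (inject₁ j) x y))
        ρ₁ y = ind (does (R? (suc j) x y))
        D y = ind (does (R? (suc j) x y) ∧ not (does (R? (inject₁ j) x y)))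

        Δ = sum D

        ρ₁-split : ∀ y → ρ₁ y ≡ ρ₀ y + D y
        ρ₁-split y = ind-split (R? (inject₁ j) x y) (R? (suc j) x y) (agree-suc e j)

        M-split : ∀ y → M x y * ρ₁ y ≡ M x y * ρ₀ y + M x x′ * D y
        M-split y = begin
          M x y * ρ₁ y                       ≡⟨ cong (M x y *_) (ρ₁-split y) ⟩
          M x y * (ρ₀ y + D y)               ≡⟨ *-distribˡ-+ (M x y) (ρ₀ y) (D y) ⟩
          M x y * ρ₀ y + M x y * D y         ≡⟨ cong (λ a → M x y * ρ₀ y + a) (ind-difference (R? (inject₁ j) x y) (R? (suc j) x y)
                                                  (λ x≁y x~y → M-sphere j x~x′ x≁x′ x~y x≁y)) ⟩
          M x y * ρ₀ y + M x x′ * D y        ∎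
          where open ≡-Reasoning

        ballSplit : ∏ e (suc j) ≡ ∏ e (inject₁ j) + Δ
        ballSplit = begin
          ∏ e (suc j)                        ≡⟨ ballSize (suc j) x ⟨
          sum ρ₁                             ≡⟨ sum-cong-≗ {N} ρ₁-split ⟩
          sum (λ y → ρ₀ y + D y)             ≡⟨ ∑-distrib-+ {N} ρ₀ D ⟩
          sum ρ₀ + Δ                         ≡⟨ cong (_+ Δ) (ballSize (inject₁ j) x) ⟩
          ∏ e (inject₁ j) + Δ                ∎
          where open ≡-Reasoning

        count : ∀ i → sum (λ y → M x y * ind (does (R? i x y))) ≡ M x x * Y i
        count i = doubleCount i 𝒳 x (Y i) (near-Y i)

        countSplit : M x x * Y (suc j) ≡ M x x * Y (inject₁ j) + M x x′ * Δ
        countSplit = begin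
          M x x * Y (suc j)                                                  ≡⟨ count (suc j) ⟨
          sum (λ y → M x y * ρ₁ y)                                           ≡⟨ sum-cong-≗ {N} M-split ⟩
          sum (λ y → M x y * ρ₀ y + M x x′ * D y)                            ≡⟨ ∑-distrib-+ {N} (λ y → M x y * ρ₀ y) (λ y → M x x′ * D y) ⟩
          sum (λ y → M x y * ρ₀ y) + sum (λ y → M x x′ * D y)                ≡⟨ cong₂ _+_ (count (inject₁ j)) (sym (*-distribˡ-sum {N} (M x x′) D)) ⟩
          M x x * Y (inject₁ j) + M x x′ * Δ                                 ∎
          where open ≡-Reasoning

        Δ≢0 : NonZero Δ
        Δ≢0 = >-nonZero (≤-trans (≤-reflexive (sym D≡1)) (term≤sum D x′))
          where
          D≡1 : D x′ ≡ 1
          D≡1 = cong₂ (λ a b → ind (a ∧ not b)) (dec-true (R? (suc j) x x′) x~x′) (dec-false (R? (inject₁ j) x x′) x≁x′)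

        -- In `countSplit` times `w`, the instances of `Y-eq` at the two levels differ by `K * Δ`.
        -- The sphere size `Δ` cancels, and with it every trace of the level `j`: this is why pairs
        -- joined at different levels lie on equally many blocks.
        M-w : M x x′ * w ≡ M x x * K
        M-w = *-cancelʳ-≡ _ _ Δ {{Δ≢0}} (+-cancelˡ-≡ (r * (w + K * c)) _ _ (begin
          r * (w + K * c) + M x x′ * w * Δ      ≡⟨ cong (λ a → r * a + M x x′ * w * Δ) (Y-eq (inject₁ j)) ⟨
          r * (Y₀ * w) + M x x′ * w * Δ         ≡⟨ gather r Y₀ w (M x x′) Δ ⟩
          (r * Y₀ + M x x′ * Δ) * w             ≡⟨ cong (_* w) countSplit ⟨
          r * Y (suc j) * w                     ≡⟨ *-assoc r (Y (suc j)) w ⟩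
          r * (Y (suc j) * w)                   ≡⟨ cong (r *_) (Y-eq (suc j)) ⟩
          r * (w + K * (∏ e (suc j) ∸ 1))       ≡⟨ cong (λ a → r * (w + K * a)) (trans (cong (_∸ 1) ballSplit) (+-∸-comm Δ (1≤∏e (inject₁ j)))) ⟩
          r * (w + K * (c + Δ))                 ≡⟨ spread r w K c Δ ⟩
          r * (w + K * c) + r * K * Δ           ∎))
          where
          open ≡-Reasoning
          open +-*-Solver
          r = M x x
          c = ∏ e (inject₁ j) ∸ 1
          Y₀ = Y (inject₁ j)

          gather : ∀ r Y w m Δ → r * (Y * w) + m * w * Δ ≡ (r * Y + m * Δ) * w
          gather = solve 5 (λ r Y w m Δ → r :* (Y :* w) :+ m :* w :* Δ := (r :* Y :+ m :* Δ) :* w) refl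

          spread : ∀ r w K c Δ → r * (w + K * (c + Δ)) ≡ r * (w + K * c) + r * K * Δ
          spread = solve 5 (λ r w K c Δ → r :* (w :+ K :* (c :+ Δ)) := r :* (w :+ K :* c) :+ r :* K :* Δ) refl

      M-w : ∀ {x y} → x ≢ y → M x y * w ≡ M x x * K
      M-w {x} {y} x≢y
        with j , x~y , x≁y ← splitLevel e (φ ⟨$⟩ʳ x) (φ ⟨$⟩ʳ y) (λ eq → x≢y (trans (sym (inverseˡ φ)) (trans (cong (φ ⟨$⟩ˡ_) eq) (inverseˡ φ))))
        = Sphere.M-w j x~y x≁y

      -- The relation M x y (v - 1) = M x x (k - 1) and the symmetry of M make M x x constant.
      M-diagonal : ∀ x y → M x x * K ≡ M y y * K
      M-diagonal x y with x ≟ y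
      ... | yes refl = refl
      ... | no  x≢y  = trans (sym (M-w x≢y)) (trans (cong (_* w) (pairCount-sym 𝒳 x y)) (M-w (x≢y ∘ sym)))

    -- The design of all uniform sets

    module UniformDesign (f : Vector ℕ s) (f≤e : ∀ j → f j ≤ e j) (1≤f : ∀ j → 1 ≤ f j)
                         (∏f-eq : ∀ i → ∏ f i * w ≡ w + K * (∏ e i ∸ 1)) where

      private
        -- The condition on the size excludes the empty set, for which `UniformIn f` is vacuous.
        IsBlock : Subset N → Set
        IsBlock B = ∣ B ∣ ≡ k × UniformIn f B

        isBlock? : ∀ B → Dec (IsBlock B)
        isBlock? B = (∣ B ∣ ℕ.≟ k) ×-dec all? (λ i → all? (λ x → (x ∈ˢ? B) →-dec (near i B x ℕ.≟ ∏ f i)))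

        𝓑 : List (Subset N)
        𝓑 = filter isBlock? (allSubsets N)

        𝓑-unique : Unique 𝓑
        𝓑-unique = filter⁺ isBlock? (allSubsets-unique N)

        ∈𝓑⁻ : ∀ {B} → B ∈ 𝓑 → IsBlock B
        ∈𝓑⁻ B∈ = proj₂ (∈-filter⁻ isBlock? {xs = allSubsets N} B∈)

        ∈𝓑⁺ : ∀ {B} → IsBlock B → B ∈ 𝓑
        ∈𝓑⁺ {B} = ∈-filter⁺ isBlock? (allSubsets-complete B)

        image-𝓑 : ∀ {g} → Symmetry g → ∀ {B} → B ∈ 𝓑 → image g B ∈ 𝓑
        image-𝓑 {g} sy {B} B∈ with size , uni ← ∈𝓑⁻ B∈ =
          ∈𝓑⁺ (trans (∣image∣ g B) size , image-uniformIn f {g} sy uni)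

        preserves-𝓑 : ∀ {g} → Symmetry g → Preserves g 𝓑
        preserves-𝓑 {g} sy = closed⇒preserves g (image-𝓑 {g} sy) (image-𝓑 {flip g} (symmetry-flip {g} sy))

        block : ∃[ B ] (UniformIn f B × ∃[ x ] x ∈ˢ B)
        block = uniformIn-exists f f≤e 1≤f

        B₀ = proj₁ block
        p = proj₁ (proj₂ (proj₂ block))

        ∣B₀∣≡k : ∣ B₀ ∣ ≡ k
        ∣B₀∣≡k = *-cancelʳ-≡ _ _ w (begin
          ∣ B₀ ∣ * w              ≡⟨ cong (_* w) (near-top B₀ p) ⟨
          near (fromℕ s) B₀ p * w ≡⟨ cong (_* w) (proj₁ (proj₂ block) (fromℕ s) p (proj₂ (proj₂ (proj₂ block)))) ⟩
          ∏ f (fromℕ s) * w       ≡⟨ ∏f-eq (fromℕ s) ⟩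
          suc K * w               ≡⟨ cong (_* w) suc-K ⟩
          k * w                   ∎)
          where open ≡-Reasoning

      module P = PairCounts 𝓑 𝓑-unique (λ {g} → preserves-𝓑 {g}) (∏ f) ∏f-eq (λ i B∈ x∈ → proj₂ (∈𝓑⁻ B∈) i _ x∈)

      -- λ is r (k - 1) / (v - 1), with r read off at the point `p` of the sample block. The
      -- division is exact because it undoes the multiplication by `w` in `P.M-w`.
      design : Design N k (pairCount 𝓑 p p * K / w)
      design = record
        { blocks    = 𝓑
        ; unique    = 𝓑-unique
        ; nonempty  = B₀ , ∈𝓑⁺ (∣B₀∣≡k , proj₁ (proj₂ block))
        ; blockSize = λ B∈ → proj₁ (∈𝓑⁻ B∈)
        ; balanced  = λ {x} {y} x≢y → trans (sym (m*n/n≡m (pairCount 𝓑 x y) w)) (/-congˡ (trans (P.M-w x≢y) (P.M-diagonal x p)))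
        }

      admits : AdmitsFlagTransitive ch design
      admits = symmetries ,
        (λ {g} sy → preserves-𝓑 {g} sy) ,
        (λ B∈ δ∈ B′∈ δ′∈ → flag-transitive f 1≤f (proj₂ (∈𝓑⁻ B∈)) (proj₂ (∈𝓑⁻ B′∈)) δ∈ δ′∈) ,
        (λ {g} sy i → symmetry-preserves {g} sy i)

theorem1p2 :
    (s k : ℕ) (e : Fin s → ℕ)
    (2≤s : 2 ≤ s) (2≤k : 2 ≤ k) (2≤e : ∀ j → 2 ≤ e j)
    (k<v : k < numPoints e)
    (ch : PartitionChain e) →
    let v = numPoints e
        instance
          v∸1≢0 = numPoints∸1-nonZero e 2≤k k<v
          d≢0 = gcdPred-nonZero e 2≤s 2≤e
    in
    ((∃[ l ] Σ[ 𝒟 ∈ Design v k l ] AdmitsFlagTransitive ch 𝒟) ⇔ (FT1 k e × FT2 k e))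
    ×
    (FT1 k e → FT2 k e →
      ∀ {l} (𝒟 : Design v k l) → AdmitsFlagTransitive ch 𝒟 →
      ∀ (j : Fin s) {C B} → C ∈ classes (𝒞 ch (suc j)) → B ∈ blocks 𝒟 →
      (∣ B ∩ C ∣ ≡ 0) ⊎ (+ ∣ B ∩ C ∣ ℚ./ 1 ≡ y k e (suc j)))
theorem1p2 s k e 2≤s 2≤k 2≤e k<v ch = mk⇔ necessary sufficient , intersections
  where
  instance
    v∸1≢0 : NonZero (numPoints e ∸ 1)
    v∸1≢0 = numPoints∸1-nonZero e 2≤k k<v

    d≢0 : NonZero (gcdPred e)
    d≢0 = gcdPred-nonZero e 2≤s 2≤e

  1≤e : ∀ j → 1 ≤ e j
  1≤e j = <⇒≤ (2≤e j)

  necessary : (∃[ l ] Σ[ 𝒟 ∈ Design (numPoints e) k l ] AdmitsFlagTransitive ch 𝒟) → FT1 k e × FT2 k e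
  necessary (l , 𝒟 , aft) = ft1 , ft2
    where
    open FlagTransitiveDesign ch 2≤k 1≤e 𝒟 aft
    open Necessary k e 1≤e Y Y-pos Y-eq Y-∣

  sufficient : FT1 k e × FT2 k e → ∃[ l ] Σ[ 𝒟 ∈ Design (numPoints e) k l ] AdmitsFlagTransitive ch 𝒟
  sufficient (ft1 , ft2) = _ , design , admits
    where
    open Sufficient k e 1≤e (∸-monoˡ-≤ 1 (<⇒≤ k<v)) ft1 ft2
    open UniformDesign ch 2≤k 1≤e f f≤e 1≤f ∏f-eq

  intersections : FT1 k e → FT2 k e → ∀ {l} (𝒟 : Design (numPoints e) k l) → AdmitsFlagTransitive ch 𝒟 →
                  ∀ (j : Fin s) {C B} → C ∈ classes (𝒞 ch (suc j)) → B ∈ blocks 𝒟 →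
                  (∣ B ∩ C ∣ ≡ 0) ⊎ (+ ∣ B ∩ C ∣ ℚ./ 1 ≡ y k e (suc j))
  intersections _ _ 𝒟 aft j {C} {B} C∈ B∈ with FlagTransitiveDesign.intersection ch 2≤k 1≤e 𝒟 aft (suc j) {C} {B} C∈ B∈
  ... | inj₁ ≡0 = inj₁ ≡0
  ... | inj₂ ≡Y = inj₂ (trans (cong (λ m → + m ℚ./ 1) ≡Y) (sym (y-≡ k e 1≤e {Y (suc j)} (suc j) (Y-eq (suc j)))))
    where open FlagTransitiveDesign ch 2≤k 1≤e 𝒟 aft
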